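{- Let $\mathcal M$ be a geometric structure with universe $M$. Let $\mathcal C(\mathcal M_{\mathrm{acl}(\emptyset)})$ be the first-order structure with universe $M$ having a relation symbol (predicate) for each $\mathrm{acl}(\emptyset)$-definable curve, i.e. for each $n\ge 1$ and each subset $X\subseteq M^n$ of dimension $\le 1$ that is definable in $\mathcal M$ with parameters from $\mathrm{acl}(\emptyset)$. Then the theory of $\mathcal C(\mathcal M_{\mathrm{acl}(\emptyset)})$ has quantifier elimination.
   Context: A structure $\mathcal M$ is a geometric structure if (these being properties of its complete theory, i.e. holding in every model of $\mathrm{Th}(\mathcal M)$): (1) Exchange: for all $a,b$ and sets $C$, if $a\in \mathrm{acl}(bC)\setminus\mathrm{acl}(C)$ then $b\in\mathrm{acl}(aC)$; (2) Uniform finiteness: for every formula $\psi(y,\mathbf w)$ there is an integer $k$ such that for every tuple $\mathbf a$ the set $\{b : \mathcal M\models\psi(b,\mathbf a)\}$ is either infinite or has at most $k$ elements. Here $\mathrm{acl}$ is the model-theoretic algebraic closure in $\mathcal M$. Dimension: if $X\subseteq M^n$ is defined by a formula $\Phi$ with parameters $B$, and $\widetilde{\mathcal M}$ is a saturated elementary extension, then $\dim X$ is the largest $d$ such that some $(a_1,\dots,a_n)$ in $\widetilde{\mathcal M}$ satisfies $\Phi$ and has a subtuple $(a_{i_1},\dots,a_{i_d})$ with $a_{i_{j+1}}\notin\mathrm{acl}(\{a_{i_1},\dots,a_{i_j}\}\cup B)$ for all $j$ (this does not depend on the choices made; the empty set has dimension $-\infty$). -}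

module Defs where

open import Data.Empty.Polymorphic using (⊥)
open import Data.Fin.Base as Fin using (Fin)
open import Data.List.Base using (List; length)
open import Data.List.Membership.Propositional using () renaming (_∈_ to _∈ˡ_)
open import Data.List.Relation.Unary.All using () renaming (All to Allˡ)
open import Data.Nat.Base using (ℕ; suc; _+_; _≤_)
open import Data.Product.Base using (Σ-syntax; ∃-syntax; _×_)
open import Data.Sum.Base using (_⊎_)
open import Data.Unit.Polymorphic using (⊤)
open import Data.Vec.Base using (Vec; []; _∷_; _++_; lookup; map)
open import Data.Vec.Membership.Propositional using () renaming (_∈_ to _∈ᵛ_)
open import Data.Vec.Relation.Unary.All using (All)
open import Function.Bundles using (_⇔_)
open import Level using (Level; _⊔_) renaming (suc to lsuc)
open import Relation.Binary.Construct.Add.Infimum.NonStrict _≤_ using (_≤₋_)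
open import Relation.Binary.PropositionalEquality.Core using (_≡_)
open import Relation.Nullary.Construct.Add.Infimum using (_₋; ⊥₋; [_])
open import Relation.Nullary.Negation.Core using (¬_)
open import Relation.Unary using (Pred; _∈_; _∉_; _∪_; ∅; ｛_｝; Empty)

private
  variable
    ℓ c : Level
    n m d : ℕ

record Language (ℓ : Level) : Set (lsuc ℓ) where
  field
    Fun : ℕ → Set ℓ
    Rel : ℕ → Set ℓ

open Language public

data Term (L : Language ℓ) (n : ℕ) : Set ℓ where
  var : Fin n → Term L n
  fun : ∀ {k} → Fun L k → Vec (Term L n) k → Term L n

-- Formula L n: formulas with free variables among n de Bruijn variables;
-- a quantifier binds variable zero.
data Formula (L : Language ℓ) (n : ℕ) : Set ℓ where
  ⊥′   : Formula L n
  _≐_  : Term L n → Term L n → Formula L n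
  rel  : ∀ {k} → Rel L k → Vec (Term L n) k → Formula L n
  _∧′_ : Formula L n → Formula L n → Formula L n
  _∨′_ : Formula L n → Formula L n → Formula L n
  _⇒′_ : Formula L n → Formula L n → Formula L n
  ∀′_  : Formula L (suc n) → Formula L n
  ∃′_  : Formula L (suc n) → Formula L n

Sentence : Language ℓ → Set ℓ
Sentence L = Formula L 0

record Structure (L : Language ℓ) : Set (lsuc ℓ) where
  field
    Carrier : Set ℓ
    funᴵ    : ∀ {k} → Fun L k → Vec Carrier k → Carrier
    relᴵ    : ∀ {k} → Rel L k → Pred (Vec Carrier k) ℓ

open Structure public

module _ {L : Language ℓ} (M : Structure L) where

  mutual
    eval : Term L n → Vec (Carrier M) n → Carrier M
    eval (var i)    v = lookup v i
    eval (fun f ts) v = funᴵ M f (evals ts v)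

    evals : ∀ {k} → Vec (Term L n) k → Vec (Carrier M) n → Vec (Carrier M) k
    evals []       v = []
    evals (t ∷ ts) v = eval t v ∷ evals ts v

infix 4 _⊨_[_]

_⊨_[_] : {L : Language ℓ} (M : Structure L) → Formula L n → Vec (Carrier M) n → Set ℓ
M ⊨ ⊥′       [ v ] = ⊥
M ⊨ s ≐ t    [ v ] = eval M s v ≡ eval M t v
M ⊨ rel R ts [ v ] = relᴵ M R (evals M ts v)
M ⊨ φ ∧′ ψ   [ v ] = (M ⊨ φ [ v ]) × (M ⊨ ψ [ v ])
M ⊨ φ ∨′ ψ   [ v ] = (M ⊨ φ [ v ]) ⊎ (M ⊨ ψ [ v ])
M ⊨ φ ⇒′ ψ   [ v ] = M ⊨ φ [ v ] → M ⊨ ψ [ v ]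
M ⊨ ∀′ φ     [ v ] = (x : Carrier M) → M ⊨ φ [ x ∷ v ]
M ⊨ ∃′ φ     [ v ] = Σ[ x ∈ Carrier M ] M ⊨ φ [ x ∷ v ]

Theory : Language ℓ → Set (lsuc ℓ)
Theory {ℓ} L = Pred (Sentence L) ℓ

Th : {L : Language ℓ} → Structure L → Theory L
Th M σ = M ⊨ σ [ [] ]

_IsModelOf_ : {L : Language ℓ} → Structure L → Theory L → Set ℓ
N IsModelOf T = ∀ σ → σ ∈ T → N ⊨ σ [ [] ]

QuantifierFree : {L : Language ℓ} → Formula L n → Set
QuantifierFree ⊥′         = ⊤
QuantifierFree (_ ≐ _)    = ⊤
QuantifierFree (rel _ _)  = ⊤
QuantifierFree (φ ∧′ ψ)   = QuantifierFree φ × QuantifierFree ψ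
QuantifierFree (φ ∨′ ψ)   = QuantifierFree φ × QuantifierFree ψ
QuantifierFree (φ ⇒′ ψ)   = QuantifierFree φ × QuantifierFree ψ
QuantifierFree (∀′ _)     = ⊥
QuantifierFree (∃′ _)     = ⊥

HasQE : {L : Language ℓ} → Theory L → Set (lsuc ℓ)
HasQE {L = L} T =
  ∀ n (φ : Formula L n) →
  Σ[ ψ ∈ Formula L n ] QuantifierFree ψ ×
    (∀ (N : Structure L) → N IsModelOf T → ∀ v → (N ⊨ φ [ v ]) ⇔ (N ⊨ ψ [ v ]))

AtMost : {A : Set ℓ} → ℕ → Pred A c → Set (ℓ ⊔ c)
AtMost {A = A} k X = Σ[ xs ∈ List A ] length xs ≤ k × (∀ x → x ∈ X → x ∈ˡ xs)

Finite : {A : Set ℓ} → Pred A c → Set (ℓ ⊔ c)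
Finite X = ∃[ k ] AtMost k X

Infinite : {A : Set ℓ} → Pred A c → Set (ℓ ⊔ c)
Infinite X = ¬ Finite X

module _ {L : Language ℓ} (M : Structure L) where

  Fibre : Formula L (suc m) → Vec (Carrier M) m → Pred (Carrier M) ℓ
  Fibre φ w y = M ⊨ φ [ y ∷ w ]

  acl : Pred (Carrier M) c → Pred (Carrier M) (ℓ ⊔ c)
  acl C a =
    ∃[ m ] Σ[ φ ∈ Formula L (suc m) ] Σ[ w ∈ Vec (Carrier M) m ]
      All C w × a ∈ Fibre φ w × Finite (Fibre φ w)

  Exchange : Set (lsuc ℓ)
  Exchange = ∀ a b (C : Pred (Carrier M) ℓ) →
    a ∈ acl (｛ b ｝ ∪ C) → a ∉ acl C → b ∈ acl (｛ a ｝ ∪ C)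

  UniformFiniteness : Set ℓ
  UniformFiniteness = ∀ m (ψ : Formula L (suc m)) →
    ∃[ k ] (∀ w → Infinite (Fibre ψ w) ⊎ AtMost k (Fibre ψ w))

IsGeometric : {L : Language ℓ} → Structure L → Set (lsuc ℓ)
IsGeometric {L = L} M =
  ∀ (N : Structure L) → N IsModelOf Th M → Exchange N × UniformFiniteness N

record ElementaryExtension {L : Language ℓ} (M : Structure L) : Set (lsuc ℓ) where
  field
    extension  : Structure L
    ι          : Carrier M → Carrier extension
    elementary : ∀ n (φ : Formula L n) v →
                 (M ⊨ φ [ v ]) ⇔ (extension ⊨ φ [ map ι v ])

-- ℵ₀-saturation: every finitely satisfiable 1-type over a finite tuple is
-- realised.  This is the weakest of the usual meanings of "saturated", and
-- enough for dimension, as a formula has only finitely many parameters.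
Saturated : {L : Language ℓ} → Structure L → Set (lsuc ℓ)
Saturated {ℓ} {L} N =
  ∀ m (w : Vec (Carrier N) m) (p : Pred (Formula L (suc m)) ℓ) →
  (∀ (φs : List (Formula L (suc m))) → Allˡ p φs →
     Σ[ a ∈ Carrier N ] Allˡ (λ φ → N ⊨ φ [ a ∷ w ]) φs) →
  Σ[ a ∈ Carrier N ] (∀ φ → φ ∈ p → N ⊨ φ [ a ∷ w ])

record SaturatedExtension {L : Language ℓ} (M : Structure L) : Set (lsuc ℓ) where
  field
    elementaryExtension : ElementaryExtension M
  open ElementaryExtension elementaryExtension public
  field
    saturated : Saturated extension

module _ {L : Language ℓ} (M : Structure L) where

  -- A definable subset of Mⁿ, presented by Φ and its tuple of parameters B.
  record Definable (n : ℕ) : Set ℓ where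
    constructor definable
    field
      {#params} : ℕ
      formula   : Formula L (n + #params)
      params    : Vec (Carrier M) #params

  open Definable public

  points : Definable n → Pred (Vec (Carrier M) n) ℓ
  points X a = M ⊨ formula X [ a ++ params X ]

module _ {L : Language ℓ} {M : Structure L} (M̃ : SaturatedExtension M) where

  open SaturatedExtension M̃

  pointsᴱ : Definable M n → Pred (Vec (Carrier extension) n) ℓ
  pointsᴱ X a = extension ⊨ formula X [ a ++ map ι (params X) ]

  paramsᴱ : Definable M n → Pred (Carrier extension) ℓ
  paramsᴱ X x = x ∈ᵛ map ι (params X)

  -- The values at the indices i₁, …, iⱼ preceding iⱼ₊₁.
  Preceding : Vec (Carrier extension) n → (Fin d → Fin n) → Fin d →
              Pred (Carrier extension) ℓ
  Preceding a i j x = ∃[ k ] k Fin.< j × x ≡ lookup a (i k)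

  HasIndependentSubtuple : Pred (Carrier extension) ℓ → Vec (Carrier extension) n →
                           ℕ → Set ℓ
  HasIndependentSubtuple {n} B a d =
    Σ[ i ∈ (Fin d → Fin n) ]
      (∀ j k → j Fin.< k → i j Fin.< i k) ×
      (∀ j → lookup a (i j) ∉ acl extension (Preceding a i j ∪ B))

  Attains : Definable M n → ℕ → Set ℓ
  Attains X d = ∃[ a ] a ∈ pointsᴱ X × HasIndependentSubtuple (paramsᴱ X) a d

  -- ⊥₋ plays the role of -∞.
  IsDim : Definable M n → ℕ ₋ → Set ℓ
  IsDim X ⊥₋    = Empty (points M X)
  IsDim X [ d ] = Attains X d × (∀ e → Attains X e → e ≤ d)

  DimAtMost : Definable M n → ℕ → Set ℓ
  DimAtMost X d = ∃[ δ ] IsDim X δ × δ ≤₋ [ d ]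

  record AclCurve (n : ℕ) : Set ℓ where
    field
      positiveArity : 1 ≤ n
      set           : Definable M n
      overAcl∅      : All (acl M ∅) (params set)
      isCurve       : DimAtMost set 1

  CurveLanguage : Language ℓ
  CurveLanguage = record { Fun = λ _ → ⊥ ; Rel = AclCurve }

  CurveStructure : Structure CurveLanguage
  CurveStructure = record
    { Carrier = Carrier M
    ; funᴵ    = λ ()
    ; relᴵ    = λ X → points M (AclCurve.set X)
    }

{-# OPTIONS --safe #-}
module Submission where

-- Call an acl(∅)-definable set balanced, relative to a set S of active coordinates,
-- if it depends only on S and fixing one active coordinate leaves finitely many
-- values for each other one.  Uniform finiteness makes balanced sets curves.
-- Conversely, saturation and exchange show that in a curve each pair of coordinates
-- has only finitely many exceptional values, all in acl(∅); naming these values writes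
-- every curve as a Boolean combination of balanced sets.
--
-- To eliminate ∃x, call a balanced set with x active and finite fibres over the other
-- variables v a link.  Intersections of links are links, and for links R, R′ with
-- E(v) = ∃x (R ∧ R′), the set R ∖ R′ is (R ∧ ¬E) ∪ R*, where R* = (R ∖ R′) ∧ E is again
-- a link.  So a quantifier-free Q(x , v) agrees, off a finite union of sets
-- "condition on v ∧ link", with a finite union of sets "condition on v ∧ U(x)", and on
-- the exceptional part it is again a finite union of the first kind.  The projection of
-- a link is balanced, and an infinite U(x) always has points off the exceptional fibre.

open import Defs
open import Axiom.ExcludedMiddle using (ExcludedMiddle)
open import Data.Empty using (⊥-elim)
open import Data.Empty.Polymorphic using () renaming (⊥ to ⊥ℓ; ⊥-elim to ⊥ℓ-elim)
open import Data.Fin.Base as Fin using (Fin; zero; suc; _↑ˡ_; _↑ʳ_; splitAt; join; lift)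
open import Data.Fin.Properties using (any?) renaming (_≟_ to _≟ᶠ_; <-cmp to <ᶠ-cmp)
open import Data.Fin.Subset using (Subset; inside; outside; ⁅_⁆; ∣_∣) renaming (_∈_ to _∈ˢ_; _∪_ to _∪ˢ_; _-_ to _-ˢ_; ⊥ to ⊥ˢ)
open import Data.Fin.Subset.Properties using (_∈?_; nonempty?; x∈⁅x⁆; x∈⁅y⁆⇒x≡y; x∈p∪q⁺; x∈p∪q⁻; ∉⊥; x∈p∧x≢y⇒x∈p-y; x∈p⇒∣p-x∣<∣p∣; p─q⊆p)
open import Data.List.Base as List using (List; []; _∷_; length)
open import Data.List.Membership.Propositional using () renaming (_∈_ to _∈ˡ_)
open import Data.List.Membership.Propositional.Properties using (∈-++⁺ˡ; ∈-++⁺ʳ)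
import Data.List.Relation.Unary.All as Allˡ
open import Data.List.Relation.Unary.Any using (here; there)
open import Data.Nat.Base using (ℕ; zero; suc; _+_; _≤_; _<_; z≤n; s≤s)
open import Data.Nat.Properties using (≤-refl; ≤-trans; n≤1+n)
open import Data.Product.Base using (Σ-syntax; ∃-syntax; _×_; _,_; proj₁; proj₂)
open import Data.Sum.Base as Sum using (_⊎_; inj₁; inj₂; [_,_]′)
open import Data.Unit.Polymorphic using (⊤)
open import Data.Vec.Base as Vec using (Vec; []; _∷_; _++_; lookup; tabulate; tail; _[_]≔_)
open import Data.Vec.Membership.Propositional using () renaming (_∈_ to _∈ᵛ_)
open import Data.Vec.Properties using (lookup-++ˡ; lookup-++ʳ; lookup-splitAt; lookup∘tabulate; lookup∘update; lookup∘update′; []≔-lookup; map-++)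
open import Data.Vec.Relation.Unary.All as All using (All; []; _∷_)
import Data.Vec.Relation.Unary.Any as Anyᵛ
open import Data.Vec.Relation.Unary.Any.Properties using (lookup-index)
open import Function.Base using (id; _∘_)
open import Function.Bundles using (_⇔_; mk⇔; module Equivalence)
open import Function.Construct.Composition using (_⇔-∘_)
open import Function.Construct.Identity using (⇔-id)
open import Level using (Level) renaming (suc to lsuc)
open import Relation.Binary.PropositionalEquality using (_≡_; refl; sym; trans; cong; cong₂; subst; subst₂; _≢_)
open import Relation.Nullary using (¬_; yes; no; toSum)
open import Relation.Binary.Definitions using (tri<; tri≈; tri>)
open import Relation.Nullary.Construct.Add.Infimum using (⊥₋; [_])
open import Relation.Binary.Construct.Add.Infimum.NonStrict _≤_ using (⊥₋≤_; [_])
open import Relation.Unary using (Pred; _∪_; ∅)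
open Equivalence using (to; from)

private
  variable
    ℓ : Level
    n m k : ℕ
    L : Language ℓ

-- Renaming of variables, and formulas expressing cardinality and slices

mutual
  renameᵗ : (Fin n → Fin m) → Term L n → Term L m
  renameᵗ ρ (var i)    = var (ρ i)
  renameᵗ ρ (fun f ts) = fun f (renameᵗˢ ρ ts)

  renameᵗˢ : (Fin n → Fin m) → Vec (Term L n) k → Vec (Term L m) k
  renameᵗˢ ρ []       = []
  renameᵗˢ ρ (t ∷ ts) = renameᵗ ρ t ∷ renameᵗˢ ρ ts

rename : (Fin n → Fin m) → Formula L n → Formula L m
rename ρ ⊥′         = ⊥′
rename ρ (s ≐ t)    = renameᵗ ρ s ≐ renameᵗ ρ t
rename ρ (rel R ts) = rel R (renameᵗˢ ρ ts)
rename ρ (φ ∧′ ψ)   = rename ρ φ ∧′ rename ρ ψ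
rename ρ (φ ∨′ ψ)   = rename ρ φ ∨′ rename ρ ψ
rename ρ (φ ⇒′ ψ)   = rename ρ φ ⇒′ rename ρ ψ
rename ρ (∀′ φ)     = ∀′ rename (lift 1 ρ) φ
rename ρ (∃′ φ)     = ∃′ rename (lift 1 ρ) φ

∃ⁿ : ∀ n → Formula L (n + m) → Formula L m
∃ⁿ zero    φ = φ
∃ⁿ (suc n) φ = ∃ⁿ n (∃′ φ)

closure : Formula L n → Sentence L
closure {n = zero}  φ = φ
closure {n = suc n} φ = closure (∀′ φ)

-- The removed point need not satisfy `φ`. The first disjunct provides for an empty carrier, in
-- which no point can be removed.
atMost : ℕ → Formula L (suc n) → Formula L n
atMost zero    φ = ∀′ (φ ⇒′ ⊥′)
atMost (suc k) φ =
  atMost k φ ∨′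
  (∃′ atMost k (rename (lift 1 suc) φ ∧′ ((var zero ≐ var (suc zero)) ⇒′ ⊥′)))

block : ∀ {n n′ m m′} → (Fin n → Fin n′) → (Fin m → Fin m′) → Fin (n + m) → Fin (n′ + m′)
block {n} {n′} {m} {m′} τ σ = join n′ m′ ∘ Sum.map τ σ ∘ splitAt n

lookup-block : ∀ {a} {A : Set a} {n n′ m m′} {τ : Fin n → Fin n′} {σ : Fin m → Fin m′}
  (u : Vec A n) (u′ : Vec A n′) (b : Vec A m) (b′ : Vec A m′) →
  (∀ i → lookup u i ≡ lookup u′ (τ i)) → (∀ i → lookup b i ≡ lookup b′ (σ i)) →
  ∀ i → lookup (u ++ b) i ≡ lookup (u′ ++ b′) (block τ σ i)
lookup-block {n = n} u u′ b b′ p q i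
  rewrite lookup-splitAt n u b i with splitAt n i
... | inj₁ j = trans (p j) (sym (lookup-++ˡ u′ b′ _))
... | inj₂ j = trans (q j) (sym (lookup-++ʳ u′ b′ _))

sliceBody : Fin n → Fin n → Formula L (n + m) → Formula L (n + (2 + m))
sliceBody {n = n} {m = m} i j φ =
  rename (block id (2 ↑ʳ_)) φ ∧′
  ((var (i ↑ˡ (2 + m)) ≐ var (n ↑ʳ suc zero)) ∧′ (var (j ↑ˡ (2 + m)) ≐ var (n ↑ʳ zero)))

-- slice i j φ (y , a , b): some z satisfying φ(z , b) has zᵢ = a and zⱼ = y.
slice : Fin n → Fin n → Formula L (n + m) → Formula L (2 + m)
slice i j φ = ∃ⁿ _ (sliceBody i j φ)

Slice : {A : Set ℓ} → (Vec A n → Set ℓ) → Fin n → Fin n → A → Pred A ℓ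
Slice R i j a y = ∃[ z ] R z × lookup z i ≡ a × lookup z j ≡ y

-- Semantics of these formulas

module _ (N : Structure L) where

  mutual
    eval-rename : (t : Term L n) {ρ : Fin n → Fin m} {u : Vec (Carrier N) n} {v : Vec (Carrier N) m} →
      (∀ i → lookup u i ≡ lookup v (ρ i)) → eval N t u ≡ eval N (renameᵗ ρ t) v
    eval-rename (var i)    p = p i
    eval-rename (fun f ts) p = cong (funᴵ N f) (evals-rename ts p)

    evals-rename : (ts : Vec (Term L n) k) {ρ : Fin n → Fin m} {u : Vec (Carrier N) n} {v : Vec (Carrier N) m} →
      (∀ i → lookup u i ≡ lookup v (ρ i)) → evals N ts u ≡ evals N (renameᵗˢ ρ ts) v
    evals-rename []       p = refl
    evals-rename (t ∷ ts) p = cong₂ _∷_ (eval-rename t p) (evals-rename ts p)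

  lookup-lift : ∀ {ρ : Fin n → Fin m} {u : Vec (Carrier N) n} {v : Vec (Carrier N) m} {x} →
    (∀ i → lookup u i ≡ lookup v (ρ i)) → ∀ i → lookup (x ∷ u) i ≡ lookup (x ∷ v) (lift 1 ρ i)
  lookup-lift p zero    = refl
  lookup-lift p (suc i) = p i

  sat-rename : (φ : Formula L n) {ρ : Fin n → Fin m} {u : Vec (Carrier N) n} {v : Vec (Carrier N) m} →
    (∀ i → lookup u i ≡ lookup v (ρ i)) → (N ⊨ φ [ u ]) ⇔ (N ⊨ rename ρ φ [ v ])
  sat-rename ⊥′         p = ⇔-id _
  sat-rename (s ≐ t)    p = mk⇔ (subst₂ _≡_ (eval-rename s p) (eval-rename t p))
                                (subst₂ _≡_ (sym (eval-rename s p)) (sym (eval-rename t p)))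
  sat-rename (rel R ts) p = mk⇔ (subst (relᴵ N R) (evals-rename ts p))
                                (subst (relᴵ N R) (sym (evals-rename ts p)))
  sat-rename (φ ∧′ ψ) p = mk⇔ (λ (a , b) → to (sat-rename φ p) a , to (sat-rename ψ p) b)
                              (λ (a , b) → from (sat-rename φ p) a , from (sat-rename ψ p) b)
  sat-rename (φ ∨′ ψ) p = mk⇔ (Sum.map (to (sat-rename φ p)) (to (sat-rename ψ p)))
                              (Sum.map (from (sat-rename φ p)) (from (sat-rename ψ p)))
  sat-rename (φ ⇒′ ψ) p = mk⇔ (λ f → to (sat-rename ψ p) ∘ f ∘ from (sat-rename φ p))
                              (λ f → from (sat-rename ψ p) ∘ f ∘ to (sat-rename φ p))
  sat-rename (∀′ φ) p = mk⇔ (λ f x → to (sat-rename φ (lookup-lift p)) (f x))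
                            (λ f x → from (sat-rename φ (lookup-lift p)) (f x))
  sat-rename (∃′ φ) p = mk⇔ (λ (x , s) → x , to (sat-rename φ (lookup-lift p)) s)
                            (λ (x , s) → x , from (sat-rename φ (lookup-lift p)) s)

  sat-∃ⁿ : ∀ n (φ : Formula L (n + m)) b →
    (N ⊨ ∃ⁿ n φ [ b ]) ⇔ (∃[ z ] N ⊨ φ [ z ++ b ])
  sat-∃ⁿ zero    φ b = mk⇔ (λ s → [] , s) (λ { ([] , s) → s })
  sat-∃ⁿ (suc n) φ b = mk⇔
    (λ s → let z , x , t = to (sat-∃ⁿ n (∃′ φ) b) s in x ∷ z , t)
    (λ { (x ∷ z , t) → from (sat-∃ⁿ n (∃′ φ) b) (z , x , t) })

  sat-closure : (φ : Formula L n) → (N ⊨ closure φ [ [] ]) ⇔ (∀ v → N ⊨ φ [ v ])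
  sat-closure {n = zero}  φ = mk⇔ (λ { s [] → s }) (λ f → f [])
  sat-closure {n = suc n} φ = mk⇔
    (λ { s (x ∷ v) → to (sat-closure (∀′ φ)) s v x })
    (λ f → from (sat-closure (∀′ φ)) (λ v x → f (x ∷ v)))

  sat-slice : ∀ (i j : Fin n) (φ : Formula L (n + m)) b a y →
    (N ⊨ slice i j φ [ y ∷ a ∷ b ]) ⇔ Slice (λ z → N ⊨ φ [ z ++ b ]) i j a y
  sat-slice {n = n} {m = m} i j φ b a y = mk⇔
    (λ s → let z , s₁ , s₂ , s₃ = to (sat-∃ⁿ n (sliceBody i j φ) c) s in
           z , from (renamed z) s₁ ,
           trans (sym (lookup-++ˡ z c i)) (trans s₂ (lookup-++ʳ z c (suc zero))) ,
           trans (sym (lookup-++ˡ z c j)) (trans s₃ (lookup-++ʳ z c zero)))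
    (λ (z , s₁ , s₂ , s₃) → from (sat-∃ⁿ n (sliceBody i j φ) c)
          (z , to (renamed z) s₁ ,
           trans (lookup-++ˡ z c i) (trans s₂ (sym (lookup-++ʳ z c (suc zero)))) ,
           trans (lookup-++ˡ z c j) (trans s₃ (sym (lookup-++ʳ z c zero)))))
    where
    c : Vec (Carrier N) (2 + m)
    c = y ∷ a ∷ b
    renamed : ∀ z → (N ⊨ φ [ z ++ b ]) ⇔ (N ⊨ rename (block id (2 ↑ʳ_)) φ [ z ++ c ])
    renamed z = sat-rename φ (lookup-block z z b c (λ _ → refl) (λ _ → refl))

-- Finite sets

module _ {A : Set ℓ} where

  AtMost-⊆ : {P Q : Pred A ℓ} → (∀ x → P x → Q x) → AtMost k Q → AtMost k P
  AtMost-⊆ P⊆Q (xs , len , cov) = xs , len , λ x p → cov x (P⊆Q x p)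

  Finite-⊆ : {P Q : Pred A ℓ} → (∀ x → P x → Q x) → Finite Q → Finite P
  Finite-⊆ P⊆Q (k , fin) = k , AtMost-⊆ P⊆Q fin

  Finite-list : {P : Pred A ℓ} (xs : List A) → (∀ x → P x → x ∈ˡ xs) → Finite P
  Finite-list xs cov = length xs , xs , ≤-refl , cov

  Finite-∪ : {P Q : Pred A ℓ} → Finite P → Finite Q → Finite (λ x → P x ⊎ Q x)
  Finite-∪ (_ , xs , _ , cov) (_ , ys , _ , cov′) =
    Finite-list (xs List.++ ys) λ { x (inj₁ p) → ∈-++⁺ˡ (cov x p) ; x (inj₂ q) → ∈-++⁺ʳ xs (cov′ x q) }

module _ (em : ExcludedMiddle ℓ) where

  ¬¬-elim : {P : Set ℓ} → ¬ ¬ P → P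
  ¬¬-elim {P} nn with em {P}
  ... | yes p = p
  ... | no ¬p = ⊥-elim (nn ¬p)

  -- The list covering `P` may contain points outside `P`, over which `Q` may be infinite; excluded
  -- middle discards them.
  Finite-⋃ : {A B : Set ℓ} {P : Pred A ℓ} {Q : A → Pred B ℓ} →
    Finite P → (∀ a → P a → Finite (Q a)) → Finite (λ b → ∃[ a ] P a × Q a b)
  Finite-⋃ {A} {B} {P} {Q} (_ , xs , _ , cov) fin =
    Finite-⊆ (λ { b (a , p , q) → a , cov a p , p , q }) (go xs)
    where
    go : ∀ xs → Finite (λ b → ∃[ a ] a ∈ˡ xs × P a × Q a b)
    go [] = Finite-list [] λ { b (a , () , _) }
    go (x ∷ xs) with em {P x}
    ... | no ¬p = Finite-⊆ (λ { b (a , here refl , p , _) → ⊥-elim (¬p p)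
                              ; b (a , there a∈ , r) → a , a∈ , r }) (go xs)
    ... | yes p = Finite-⊆ (λ { b (a , here refl , _ , q) → inj₁ q
                              ; b (a , there a∈ , r) → inj₂ (a , a∈ , r) })
                           (Finite-∪ (fin x p) (go xs))

  Infinite-∖ : {A : Set ℓ} {P Q : Pred A ℓ} → Infinite P → Finite Q → ∃[ a ] P a × ¬ Q a
  Infinite-∖ {P = P} {Q} inf fin = ¬¬-elim λ none → inf (Finite-⊆ (λ x p → ¬¬-elim λ ¬q → none (x , p , ¬q)) fin)

  -- The removed point is the head of the covering list; excluded middle separates it from the rest.
  sat-atMost : {L : Language ℓ} (N : Structure L) → ∀ k (φ : Formula L (suc n)) v →
    (N ⊨ atMost k φ [ v ]) ⇔ AtMost k (Fibre N φ v)
  sat-atMost N zero φ v = mk⇔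
    (λ none → [] , z≤n , λ x s → ⊥ℓ-elim (none x s))
    (λ { ([] , _ , cov) x s → ⊥-elim (case[] (cov x s)) })
    where
    case[] : ∀ {x} → ¬ (x ∈ˡ [])
    case[] ()
  sat-atMost {n} {L} N (suc k) φ v = mk⇔ ⇒ ⇐
    where
    φ∖ : Formula L (suc (suc n))
    φ∖ = rename (lift 1 suc) φ ∧′ ((var zero ≐ var (suc zero)) ⇒′ ⊥′)
    renamed : ∀ x y → (N ⊨ φ [ x ∷ v ]) ⇔ (N ⊨ rename (lift 1 suc) φ [ x ∷ y ∷ v ])
    renamed x y = sat-rename N φ (lookup-lift N (λ _ → refl))
    ⇒ : N ⊨ atMost (suc k) φ [ v ] → AtMost (suc k) (Fibre N φ v)
    ⇒ (inj₁ s) = let xs , len , cov = to (sat-atMost N k φ v) s in xs , ≤-trans len (n≤1+n k) , cov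
    ⇒ (inj₂ (y , s)) with to (sat-atMost N k φ∖ (y ∷ v)) s
    ... | xs , len , cov = y ∷ xs , s≤s len , covers
      where
      covers : ∀ x → N ⊨ φ [ x ∷ v ] → x ∈ˡ y ∷ xs
      covers x t with em {x ≡ y}
      ... | yes x≡y = here x≡y
      ... | no  x≢y = there (cov x (to (renamed x y) t , λ e → ⊥-elim (x≢y e)))
    ⇐ : AtMost (suc k) (Fibre N φ v) → N ⊨ atMost (suc k) φ [ v ]
    ⇐ ([] , _ , cov) = inj₁ (from (sat-atMost N k φ v) ([] , z≤n , cov))
    ⇐ (y ∷ xs , s≤s len , cov) = inj₂ (y , from (sat-atMost N k φ∖ (y ∷ v)) (xs , len , covers))
      where
      covers : ∀ x → N ⊨ φ∖ [ x ∷ y ∷ v ] → x ∈ˡ xs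
      covers x (t , x≢y) with cov x (from (renamed x y) t)
      ... | here x≡y  = ⊥ℓ-elim (x≢y x≡y)
      ... | there x∈  = x∈

-- Algebraic closure and generic points of a saturated structure

module _ {L : Language ℓ} (N : Structure L) where

  acl-⊆ : {C D : Pred (Carrier N) ℓ} → (∀ {x} → C x → D x) → ∀ {a} → acl N C a → acl N D a
  acl-⊆ C⊆D (m , φ , w , w⊆C , rest) = m , φ , w , All.map C⊆D w⊆C , rest

  indices : {w : Vec (Carrier N) m} {w′ : Vec (Carrier N) k} → All (_∈ᵛ w) w′ →
    Σ[ σ ∈ (Fin k → Fin m) ] (∀ i → lookup w′ i ≡ lookup w (σ i))
  indices [] = (λ ()) , λ ()
  indices (x∈w ∷ xs∈w) with indices xs∈w
  ... | σ , eq = (λ { zero → Anyᵛ.index x∈w ; (suc i) → σ i }) ,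
                 (λ { zero → lookup-index x∈w ; (suc i) → eq i })

  all-∈ : (w : Vec (Carrier N) m) → All (_∈ᵛ w) w
  all-∈ []      = []
  all-∈ (x ∷ w) = Anyᵛ.here refl ∷ All.map Anyᵛ.there (all-∈ w)

  -- Saturation realises the type formed by `φ` and the negations of all formulas with finite fibre
  -- over `w`. Finitely many of these remove only a finite set, so an infinite fibre of `φ` always
  -- has a point left.
  generic : ExcludedMiddle ℓ → Saturated N → (w : Vec (Carrier N) m) (φ : Formula L (suc m)) →
    Infinite (Fibre N φ w) → ∃[ a ] N ⊨ φ [ a ∷ w ] × ¬ acl N (_∈ᵛ w) a
  generic {m} em saturated w φ inf = a , realised φ (inj₁ refl) , not-algebraic
    where
    p : Pred (Formula L (suc m)) ℓ
    p ψ = ψ ≡ φ ⊎ Σ[ θ ∈ Formula L (suc m) ] ψ ≡ (θ ⇒′ ⊥′) × Finite (Fibre N θ w)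
    avoid : ∀ ψs → Allˡ.All p ψs → Σ[ T ∈ Pred (Carrier N) ℓ ] Finite T ×
      (∀ a → N ⊨ φ [ a ∷ w ] → ¬ T a → Allˡ.All (λ ψ → N ⊨ ψ [ a ∷ w ]) ψs)
    avoid [] Allˡ.[] = (λ _ → ⊥ℓ) , Finite-list [] (λ _ ()) , λ _ _ _ → Allˡ.[]
    avoid (ψ ∷ ψs) (inj₁ refl Allˡ.∷ ps) =
      let T , fin , sat = avoid ψs ps in T , fin , λ a φa ok → φa Allˡ.∷ sat a φa ok
    avoid (ψ ∷ ψs) (inj₂ (θ , refl , finθ) Allˡ.∷ ps) =
      let T , fin , sat = avoid ψs ps in
      (λ a → N ⊨ θ [ a ∷ w ] ⊎ T a) , Finite-∪ finθ fin ,
      λ a φa ok → (λ θa → ⊥-elim (ok (inj₁ θa))) Allˡ.∷ sat a φa (ok ∘ inj₂)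
    realisation : Σ[ a ∈ Carrier N ] (∀ ψ → p ψ → N ⊨ ψ [ a ∷ w ])
    realisation = saturated m w p λ ψs ps →
      let _ , fin , sat = avoid ψs ps
          a , φa , ok   = Infinite-∖ em inf fin
      in a , sat a φa ok
    a : Carrier N
    a = proj₁ realisation
    realised : ∀ ψ → p ψ → N ⊨ ψ [ a ∷ w ]
    realised = proj₂ realisation
    not-algebraic : ¬ acl N (_∈ᵛ w) a
    -- A witness of algebraicity may list its parameters in any order and with repetitions; `σ`
    -- rewrites it over `w`, where its negation belongs to `p`.
    not-algebraic (m′ , θ , w′ , w′⊆w , θa , fin) with indices w′⊆w
    ... | σ , eq = ⊥ℓ-elim (realised (rename (lift 1 σ) θ ⇒′ ⊥′)
            (inj₂ (_ , refl , Finite-⊆ (λ x → from (renamed x)) fin)) (to (renamed a) θa))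
      where
      renamed : ∀ x → (N ⊨ θ [ x ∷ w′ ]) ⇔ (N ⊨ rename (lift 1 σ) θ [ x ∷ w ])
      renamed x = sat-rename N θ (lookup-lift N eq)

-- Slices of curves and the dimension bound

module Curves (em : ExcludedMiddle ℓ) {L : Language ℓ} (M : Structure L) (geometric : IsGeometric M)
              (M̃ : SaturatedExtension M) where

  open SaturatedExtension M̃

  private
    N : Structure L
    N = extension

  uniformFiniteness : UniformFiniteness M
  uniformFiniteness = proj₂ (geometric M (λ _ s → s))

  exchange : Exchange N
  exchange = proj₁ (geometric N (λ σ → to (elementary 0 σ [])))

  Controls : (Vec (Carrier M) n → Set ℓ) → Fin n → Fin n → Set ℓ
  Controls R i j = ∀ a → Finite (Slice R i j a)

  -- Having at most `k` solutions is first order for each `k`, so a bound found in the extension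
  -- comes back to `M`.
  Infinite-ι : (φ : Formula L (suc m)) (b : Vec (Carrier M) m) →
    Infinite (Fibre M φ b) → Infinite (Fibre N φ (Vec.map ι b))
  Infinite-ι φ b inf (k , few) = inf (k , to (sat-atMost em M k φ b)
    (from (elementary _ (atMost k φ) b) (from (sat-atMost em N k φ (Vec.map ι b)) few)))

  attains-2 : (X : Definable M n) (z : Vec (Carrier N) n) {i j : Fin n} → i Fin.< j → pointsᴱ M̃ X z →
    ¬ acl N (paramsᴱ M̃ X) (lookup z i) →
    ¬ acl N (_∈ᵛ (lookup z i ∷ Vec.map ι (params X))) (lookup z j) →
    Attains M̃ X 2
  attains-2 {n} X z {i} {j} i<j z∈X free₁ free₂ = z , z∈X , idx , increasing , free
    where
    idx : Fin 2 → Fin n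
    idx zero       = i
    idx (suc zero) = j
    increasing : ∀ p q → p Fin.< q → idx p Fin.< idx q
    increasing zero       (suc zero) _        = i<j
    increasing (suc zero) (suc zero) (s≤s ())
    free : ∀ p → ¬ acl N (Preceding M̃ z idx p ∪ paramsᴱ M̃ X) (lookup z (idx p))
    free zero       = free₁ ∘ acl-⊆ N λ { (inj₂ x∈B) → x∈B }
    free (suc zero) = free₂ ∘ acl-⊆ N λ
      { (inj₁ (zero , _ , x≡)) → Anyᵛ.here x≡
      ; (inj₁ (suc zero , s≤s () , _))
      ; (inj₂ x∈B) → Anyᵛ.there x∈B }

  -- Otherwise a generic `a` with infinite slice, followed by a `y` in that slice generic over `a`,
  -- gives a point of `X` in the extension with two independent coordinates.
  curve-thin : (X : Definable M n) → DimAtMost M̃ X 1 → ∀ i j →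
    Finite (λ a → Infinite (Slice (points M X) i j a))
  curve-thin X (⊥₋ , empty , _) i j =
    Finite-list [] λ a inf → ⊥-elim (inf (Finite-list [] λ { y (z , z∈X , _) → ⊥-elim (empty z z∈X) }))
  curve-thin {n} X@(definable {m} φ b) ([ d ] , (_ , maximal) , [ d≤1 ]) i j =
    ¬¬-elim em λ inf → not-attained (attained inf)
    where
    B : Vec (Carrier N) m
    B = Vec.map ι b
    θ : Formula L (2 + m)
    θ = slice i j φ
    bound : ∃[ r ] (∀ w → Infinite (Fibre M θ w) ⊎ AtMost r (Fibre M θ w))
    bound = uniformFiniteness _ θ
    K : ℕ
    K = proj₁ bound
    -- By uniform finiteness a slice in `M` is infinite exactly when it has more than `K` values,
    -- which is a first-order condition on `a`.
    θ∞ : Formula L (suc m)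
    θ∞ = atMost K θ ⇒′ ⊥′
    not-attained : ¬ Attains M̃ X 2
    not-attained at with ≤-trans (maximal 2 at) d≤1
    ... | s≤s ()
    many : ∀ a → Infinite (Slice (points M X) i j a) → M ⊨ θ∞ [ a ∷ b ]
    many a infₐ few = ⊥-elim (infₐ (Finite-⊆ (λ y → from (sat-slice M i j φ b a y))
                        (K , to (sat-atMost em M K θ (a ∷ b)) few)))
    -- For each `r`, that a slice satisfying `θ∞` does not have at most `r` values is first order
    -- over `b`; it holds in `M` by the choice of `K` and transfers to the extension.
    infinite : ∀ a → N ⊨ θ∞ [ a ∷ B ] → Infinite (Fibre N θ (a ∷ B))
    infinite a θ∞a (r , few) = ⊥ℓ-elim (to (elementary _ (∀′ (θ∞ ⇒′ (atMost r θ ⇒′ ⊥′))) b)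
        (λ x θ∞x few′ → [ (λ inf → ⊥-elim (inf (r , to (sat-atMost em M r θ (x ∷ b)) few′)))
                        , (λ few″ → θ∞x (from (sat-atMost em M K θ (x ∷ b)) few″)) ]′ (proj₂ bound (x ∷ b)))
        a θ∞a (from (sat-atMost em N r θ (a ∷ B)) few))
    attained : Infinite (λ a → Infinite (Slice (points M X) i j a)) → Attains M̃ X 2
    attained inf with generic N em saturated B θ∞ (Infinite-ι θ∞ b (inf ∘ Finite-⊆ many))
    ... | a , θ∞a , a∉ with generic N em saturated (a ∷ B) θ (infinite a θ∞a)
    ... | y , θy , y∉ with to (sat-slice N i j φ B a y) θy
    ... | z , z∈X , refl , refl with <ᶠ-cmp i j
    ... | tri< i<j _ _ = attains-2 X z i<j z∈X a∉ y∉
    -- Here `y` is `a` itself, which is algebraic over `a`.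
    ... | tri≈ _ refl _ = ⊥-elim (y∉ (1 , (var zero ≐ var (suc zero)) , (a ∷ []) , (Anyᵛ.here refl ∷ []) , refl ,
                                   Finite-list (a ∷ []) λ { x refl → here refl }))
    -- Subtuples are listed by increasing index, so `y` now precedes `a`; exchange turns the
    -- independence around.
    ... | tri> _ _ j<i = attains-2 X z j<i z∈X (y∉ ∘ acl-⊆ N Anyᵛ.there) λ a∈ → y∉
            (acl-⊆ N (λ { (inj₁ a≡x) → Anyᵛ.here (sym a≡x) ; (inj₂ x∈B) → Anyᵛ.there x∈B })
              (exchange _ _ (_∈ᵛ B) (acl-⊆ N (λ { (Anyᵛ.here x≡y) → inj₁ (sym x≡y) ; (Anyᵛ.there x∈B) → inj₂ x∈B }) a∈) a∉))

  -- Uniform finiteness gives one bound for all the finite slices, so the control is first order and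
  -- holds in the extension. There each coordinate of a point is algebraic over any other together
  -- with the parameters, which excludes an independent pair.
  controlled-curve : (X : Definable M n) → (∀ i j → Controls (points M X) i j) → DimAtMost M̃ X 1
  controlled-curve {n} X@(definable {m} φ b) controls = dimension
    where
    B : Vec (Carrier N) m
    B = Vec.map ι b
    dependent : (z : Vec (Carrier N) n) → pointsᴱ M̃ X z → ∀ i j →
      acl N (_∈ᵛ (lookup z i ∷ B)) (lookup z j)
    dependent z z∈X i j with uniformFiniteness _ (slice i j φ)
    ... | k , uf = _ , slice i j φ , lookup z i ∷ B , all-∈ N _ , from (sat-slice N i j φ B _ _) (z , z∈X , refl , refl) ,
          k , to (sat-atMost em N k (slice i j φ) _) (to (elementary _ (∀′ atMost k (slice i j φ)) b) few (lookup z i))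
      where
      few : ∀ a → M ⊨ atMost k (slice i j φ) [ a ∷ b ]
      few a with uf (a ∷ b)
      ... | inj₁ inf = ⊥-elim (inf (Finite-⊆ (λ y → to (sat-slice M i j φ b a y)) (controls i j a)))
      ... | inj₂ few′ = from (sat-atMost em M k (slice i j φ) (a ∷ b)) few′
    at-most-1 : ∀ e → Attains M̃ X e → e ≤ 1
    at-most-1 zero          _ = z≤n
    at-most-1 (suc zero)    _ = s≤s z≤n
    at-most-1 (suc (suc e)) (z , z∈X , idx , _ , free) = ⊥-elim (free (suc zero)
      (acl-⊆ N (λ { (Anyᵛ.here x≡) → inj₁ (zero , s≤s z≤n , x≡) ; (Anyᵛ.there x∈B) → inj₂ x∈B })
        (dependent z z∈X (idx zero) (idx (suc zero)))))
    dimension : DimAtMost M̃ X 1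
    -- An exact dimension is required; excluded middle decides between 1, 0 and the empty set.
    dimension with em {Attains M̃ X 1} | em {Attains M̃ X 0}
    ... | yes at₁ | _ = [ 1 ] , (at₁ , at-most-1) , [ ≤-refl ]
    ... | no ¬at₁ | yes at₀ = [ 0 ] , (at₀ , at-most-0) , [ z≤n ]
      where
      at-most-0 : ∀ e → Attains M̃ X e → e ≤ 0
      at-most-0 zero          _  = z≤n
      at-most-0 (suc zero)    at = ⊥-elim (¬at₁ at)
      at-most-0 (suc (suc e)) at with at-most-1 _ at
      ... | s≤s ()
    -- A point in `M` would map to one in the extension, where the empty subtuple already attains 0.
    ... | no _ | no ¬at₀ = ⊥₋ , (λ z z∈X → ¬at₀ (Vec.map ι z ,
            subst (N ⊨ φ [_]) (map-++ ι z b) (to (elementary _ φ (z ++ b)) z∈X) ,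
            (λ ()) , (λ ()) , (λ ()))) , (⊥₋≤ _)

  private
    A : Set ℓ
    A = Carrier M

    C : Structure (CurveLanguage M̃)
    C = CurveStructure M̃

  -- Definability over acl(∅)

  -- Induction on the parameters. The first one, `b₀`, is among the finitely many solutions `z` of
  -- `χ`; quantifying over these `z`, restricted to those for which `φ` has at most `k` solutions,
  -- removes `b₀` and keeps the fibre finite.
  acl∅-closed : (φ : Formula L (suc m)) (b : Vec A m) → All (acl M ∅) b → Finite (Fibre M φ b) →
    ∀ {c} → M ⊨ φ [ c ∷ b ] → acl M ∅ c
  acl∅-closed φ [] [] fin φc = 0 , φ , [] , [] , φc , fin
  acl∅-closed {suc m} φ (b₀ ∷ b) ((_ , χ , [] , [] , χb₀ , finχ) ∷ b⊆acl) (k , few) {c} φc =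
    acl∅-closed φ′ b b⊆acl
      (Finite-⊆ (λ { y (z , χz , φyz , fewz) →
          z , from (renχ z y) χz , from (renφ z y) φyz , from (ren# z y) fewz })
        (Finite-⋃ em finχ λ z _ → finite z))
      (b₀ , to (renχ b₀ c) χb₀ , to (renφ b₀ c) φc , to (ren# b₀ c) (from (sat-atMost em M k φ (b₀ ∷ b)) few))
    where
    swap : Fin (2 + m) → Fin (2 + m)
    swap zero          = suc zero
    swap (suc zero)    = zero
    swap (suc (suc i)) = suc (suc i)
    φ′ : Formula L (suc m)
    φ′ = ∃′ (rename (λ _ → zero) χ ∧′ (rename swap φ ∧′ rename (lift 1 suc) (atMost k φ)))
    renχ : ∀ z y → (M ⊨ χ [ z ∷ [] ]) ⇔ (M ⊨ rename (λ _ → zero) χ [ z ∷ y ∷ b ])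
    renχ z y = sat-rename M χ λ { zero → refl }
    renφ : ∀ z y → (M ⊨ φ [ y ∷ z ∷ b ]) ⇔ (M ⊨ rename swap φ [ z ∷ y ∷ b ])
    renφ z y = sat-rename M φ λ { zero → refl ; (suc zero) → refl ; (suc (suc i)) → refl }
    ren# : ∀ z y → (M ⊨ atMost k φ [ z ∷ b ]) ⇔ (M ⊨ rename (lift 1 suc) (atMost k φ) [ z ∷ y ∷ b ])
    ren# z y = sat-rename M (atMost k φ) (lookup-lift M λ _ → refl)
    finite : ∀ z → Finite (λ y → M ⊨ φ [ y ∷ z ∷ b ] × M ⊨ atMost k φ [ z ∷ b ])
    finite z with em {M ⊨ atMost k φ [ z ∷ b ]}
    ... | yes s = Finite-⊆ (λ _ → proj₁) (k , to (sat-atMost em M k φ (z ∷ b)) s)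
    ... | no ¬s = Finite-list [] λ _ (_ , s) → ⊥-elim (¬s s)

  record Def (P : Vec A n → Set ℓ) : Set ℓ where
    constructor def
    field
      set  : Definable M n
      over : All (acl M ∅) (params set)
      sat  : ∀ v → P v ⇔ points M set v

  def-cong : {P Q : Vec A n → Set ℓ} → (∀ v → Q v ⇔ P v) → Def P → Def Q
  def-cong e (def X over sat) = def X over λ v → sat v ⇔-∘ e v

  def-map : {P : Vec A n → Set ℓ} (f : Vec A m → Vec A n) (ρ : Fin n → Fin m) →
    (∀ v i → lookup (f v) i ≡ lookup v (ρ i)) → Def P → Def (P ∘ f)
  def-map f ρ eq (def (definable φ b) over sat) = def (definable (rename (block ρ id) φ) b) over λ v →
    sat-rename M φ (lookup-block (f v) v b b (eq v) (λ _ → refl)) ⇔-∘ sat (f v)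

  def-const : {P : Vec A (suc n) → Set ℓ} {c : A} → acl M ∅ c → Def P → Def (λ v → P (c ∷ v))
  def-const {n} {c = c} c∈acl (def (definable {m} φ b) over sat) =
    def (definable (rename ρ φ) (c ∷ b)) (c∈acl ∷ over) λ v → sat-rename M φ (eq v) ⇔-∘ sat (c ∷ v)
    where
    ρ : Fin (suc n + m) → Fin (n + suc m)
    ρ zero    = n ↑ʳ zero
    ρ (suc i) = block id suc i
    eq : ∀ v i → lookup (c ∷ v ++ b) i ≡ lookup (v ++ c ∷ b) (ρ i)
    eq v zero    = sym (lookup-++ʳ v (c ∷ b) zero)
    eq v (suc i) = lookup-block v v b (c ∷ b) (λ _ → refl) (λ _ → refl) i

  def-∧ : {P Q : Vec A n → Set ℓ} → Def P → Def Q → Def (λ v → P v × Q v)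
  def-∧ {n} (def (definable {m} φ b) over sat) (def (definable {m′} φ′ b′) over′ sat′) =
    def (definable (rename ρ φ ∧′ rename ρ′ φ′) (b ++ b′)) (append over over′) λ v →
      mk⇔ (λ (p , q) → to (e v ⇔-∘ sat v) p , to (e′ v ⇔-∘ sat′ v) q)
          (λ (p , q) → from (e v ⇔-∘ sat v) p , from (e′ v ⇔-∘ sat′ v) q)
    where
    ρ : Fin (n + m) → Fin (n + (m + m′))
    ρ = block {n} id (_↑ˡ m′)
    ρ′ : Fin (n + m′) → Fin (n + (m + m′))
    ρ′ = block {n} id (m ↑ʳ_)
    e : ∀ v → (M ⊨ φ [ v ++ b ]) ⇔ (M ⊨ rename ρ φ [ v ++ b ++ b′ ])
    e v = sat-rename M φ (lookup-block v v b (b ++ b′) (λ _ → refl) (λ i → sym (lookup-++ˡ b b′ i)))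
    e′ : ∀ v → (M ⊨ φ′ [ v ++ b′ ]) ⇔ (M ⊨ rename ρ′ φ′ [ v ++ b ++ b′ ])
    e′ v = sat-rename M φ′ (lookup-block v v b′ (b ++ b′) (λ _ → refl) (λ i → sym (lookup-++ʳ b b′ i)))
    append : ∀ {m m′} {b : Vec A m} {b′ : Vec A m′} →
      All (acl M ∅) b → All (acl M ∅) b′ → All (acl M ∅) (b ++ b′)
    append []       qs = qs
    append (p ∷ ps) qs = p ∷ append ps qs

  def-¬ : {P : Vec A n → Set ℓ} → Def P → Def (λ v → ¬ P v)
  def-¬ (def (definable φ b) over sat) = def (definable (φ ⇒′ ⊥′) b) over λ v →
    mk⇔ (λ ¬p s → ⊥-elim (¬p (from (sat v) s))) (λ ¬s p → ⊥ℓ-elim (¬s (to (sat v) p)))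

  def-⊤ : {P : Vec A n → Set ℓ} → (∀ v → P v) → Def P
  def-⊤ p = def (definable (⊥′ ⇒′ ⊥′) []) [] λ v → mk⇔ (λ _ s → s) (λ _ → p v)

  def-∃ : {P : Vec A (suc n) → Set ℓ} → Def P → Def (λ v → ∃[ x ] P (x ∷ v))
  def-∃ (def (definable φ b) over sat) = def (definable (∃′ φ) b) over λ v →
    mk⇔ (λ (x , p) → x , to (sat (x ∷ v)) p) (λ (x , s) → x , from (sat (x ∷ v)) s)

  def-⋀ : {P : Fin k → Vec A n → Set ℓ} → (∀ i → Def (P i)) → Def (λ v → ∀ i → P i v)
  def-⋀ {zero}  d = def-⊤ λ _ ()
  def-⋀ {suc k} d = def-cong (λ v → mk⇔ (λ p → p zero , λ i → p (suc i)) (λ (p₀ , p) → λ { zero → p₀ ; (suc i) → p i }))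
    (def-∧ (d zero) (def-⋀ λ i → d (suc i)))

  def-≡ : (i j : Fin n) → Def (λ v → lookup v i ≡ lookup v j)
  def-≡ i j = def (definable (var (i ↑ˡ 0) ≐ var (j ↑ˡ 0)) []) [] λ v →
    mk⇔ (λ e → trans (lookup-++ˡ v [] i) (trans e (sym (lookup-++ˡ v [] j))))
        (λ e → trans (sym (lookup-++ˡ v [] i)) (trans e (lookup-++ˡ v [] j)))

  -- Uniform finiteness supplies one `k` for all fibres, so `atMost k` expresses finiteness.
  def-Finite : {P : Vec A (suc n) → Set ℓ} → Def P → Def (λ v → Finite (λ x → P (x ∷ v)))
  def-Finite (def (definable φ b) over sat) with uniformFiniteness _ φ
  ... | k , uf = def (definable (atMost k φ) b) over λ v → mk⇔
    (λ fin → [ (λ inf → ⊥-elim (inf (Finite-⊆ (λ x → from (sat (x ∷ v))) fin)))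
             , from (sat-atMost em M k φ (v ++ b)) ]′ (uf (v ++ b)))
    (λ s → Finite-⊆ (λ x → to (sat (x ∷ v))) (k , to (sat-atMost em M k φ (v ++ b)) s))

  def-Slice : {R : Vec A n → Set ℓ} → Def R → ∀ i j →
    Def {2} (λ u → Slice R i j (lookup u (suc zero)) (lookup u zero))
  def-Slice (def (definable φ b) over sat) i j = def (definable (slice i j φ) b) over λ { (y ∷ a ∷ []) →
    mk⇔ (λ (z , Rz , e) → from (sat-slice M i j φ b a y) (z , to (sat z) Rz , e))
        (λ s → let z , φz , e = to (sat-slice M i j φ b a y) s in z , from (sat z) φz , e) }

  def-acl : {P : Vec A 1 → Set ℓ} → Def P → Finite (λ x → P (x ∷ [])) → ∀ {c} → P (c ∷ []) → acl M ∅ c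
  def-acl (def (definable φ b) over sat) fin p =
    acl∅-closed φ b over (Finite-⊆ (λ x → from (sat (x ∷ []))) fin) (to (sat _) p)

  -- Quantifier-free definability in the curve structure

  QF : (Vec A n → Set ℓ) → Set ℓ
  QF {n} P = Σ[ ψ ∈ Formula (CurveLanguage M̃) n ] QuantifierFree ψ × (∀ v → P v ⇔ (C ⊨ ψ [ v ]))

  qf-cong : {P Q : Vec A n → Set ℓ} → (∀ v → Q v ⇔ P v) → QF P → QF Q
  qf-cong e (ψ , qf , sat) = ψ , qf , λ v → sat v ⇔-∘ e v

  qf-∧ : {P Q : Vec A n → Set ℓ} → QF P → QF Q → QF (λ v → P v × Q v)
  qf-∧ (ψ , qf , sat) (ψ′ , qf′ , sat′) = ψ ∧′ ψ′ , (qf , qf′) , λ v →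
    mk⇔ (λ (p , q) → to (sat v) p , to (sat′ v) q) (λ (p , q) → from (sat v) p , from (sat′ v) q)

  qf-∨ : {P Q : Vec A n → Set ℓ} → QF P → QF Q → QF (λ v → P v ⊎ Q v)
  qf-∨ (ψ , qf , sat) (ψ′ , qf′ , sat′) = ψ ∨′ ψ′ , (qf , qf′) , λ v →
    mk⇔ (Sum.map (to (sat v)) (to (sat′ v))) (Sum.map (from (sat v)) (from (sat′ v)))

  qf-⇒ : {P Q : Vec A n → Set ℓ} → QF P → QF Q → QF (λ v → P v → Q v)
  qf-⇒ (ψ , qf , sat) (ψ′ , qf′ , sat′) = ψ ⇒′ ψ′ , (qf , qf′) , λ v →
    mk⇔ (λ f → to (sat′ v) ∘ f ∘ from (sat v)) (λ f → from (sat′ v) ∘ f ∘ to (sat v))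

  qf-⊥ : {P : Vec A n → Set ℓ} → (∀ v → ¬ P v) → QF P
  qf-⊥ ¬p = ⊥′ , _ , λ v → mk⇔ (λ p → ⊥-elim (¬p v p)) λ ()

  qf-¬ : {P : Vec A n → Set ℓ} → QF P → QF (λ v → ¬ P v)
  qf-¬ qf = qf-cong (λ v → mk⇔ (λ ¬p p → ⊥-elim (¬p p)) (λ f p → ⊥ℓ-elim (f p))) (qf-⇒ qf (qf-⊥ {P = λ _ → ⊥ℓ} λ _ ()))

  qf-⊤ : {P : Vec A n → Set ℓ} → (∀ v → P v) → QF P
  qf-⊤ p = qf-cong (λ v → mk⇔ (λ _ ()) (λ _ → p v)) (qf-¬ (qf-⊥ {P = λ _ → ⊥ℓ} λ _ ()))

  -- Balanced sets

  Controls-map : {R : Vec A n → Set ℓ} {W : Vec A m → Set ℓ} (f : Vec A m → Vec A n) → (∀ z → W z → R (f z)) →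
    ∀ {i j i′ j′} → (∀ z → lookup (f z) i ≡ lookup z i′) → (∀ z → lookup (f z) j ≡ lookup z j′) →
    Controls R i j → Controls W i′ j′
  Controls-map f W⊆R eqᵢ eqⱼ ctl a = Finite-⊆
    (λ { y (z , Wz , refl , refl) → f z , W⊆R z Wz , eqᵢ z , eqⱼ z }) (ctl a)

  Controls-⊆ : {R W : Vec A n → Set ℓ} → (∀ z → W z → R z) → ∀ {i j} → Controls R i j → Controls W i j
  Controls-⊆ W⊆R = Controls-map id W⊆R (λ _ → refl) (λ _ → refl)

  Controls-trans : {R : Vec A n → Set ℓ} → ∀ {i j l} → Controls R i j → Controls R j l → Controls R i l
  Controls-trans ctl ctl′ a = Finite-⊆
    (λ { y (z , Rz , e , e′) → _ , (z , Rz , e , refl) , (z , Rz , refl , e′) })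
    (Finite-⋃ em (ctl a) λ c _ → ctl′ c)

  Local : Subset n → (Vec A n → Set ℓ) → Set ℓ
  Local S R = ∀ {u v} → (∀ i → i ∈ˢ S → lookup u i ≡ lookup v i) → R u → R v

  record Balanced (S : Subset n) (R : Vec A n → Set ℓ) : Set ℓ where
    field
      definition : Def R
      local      : Local S R
      controls   : ∀ {i j} → i ∈ˢ S → j ∈ˢ S → Controls R i j

  open Balanced

  -- A slice of the projection lies in the slice of `R` at the shifted coordinates, whatever the
  -- quantified value.
  balanced-∃ : ∀ {s S} {R : Vec A (suc n) → Set ℓ} → Balanced (s ∷ S) R → Balanced S (λ v → ∃[ x ] R (x ∷ v))
  balanced-∃ β = record
    { definition = def-∃ (definition β)
    ; local      = λ agree (x , Rx) → x , local β (λ { zero _ → refl ; (suc i) (Vec.there i∈S) → agree i i∈S }) Rx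
    ; controls   = λ i∈S j∈S a → Finite-⊆ (λ { y (z , (x , Rx) , e) → x ∷ z , Rx , e })
                     (controls β (Vec.there i∈S) (Vec.there j∈S) a)
    }

  -- The shared coordinate `h` joins the two supports: `i` controls `h` within one set, and `h`
  -- controls `j` within the other.
  balanced-∧ : ∀ {S S′} {R R′ : Vec A n → Set ℓ} {h} → h ∈ˢ S → h ∈ˢ S′ →
    Balanced S R → Balanced S′ R′ → Balanced (S ∪ˢ S′) (λ z → R z × R′ z)
  balanced-∧ {S = S} {S′} {R} {R′} {h} h∈S h∈S′ β β′ = record
    { definition = def-∧ (definition β) (definition β′)
    ; local      = λ agree (Rz , R′z) → local β (λ i i∈ → agree i (x∈p∪q⁺ (inj₁ i∈))) Rz ,
                                        local β′ (λ i i∈ → agree i (x∈p∪q⁺ (inj₂ i∈))) R′z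
    ; controls   = λ i∈ j∈ → Controls-trans (toward i∈) (away j∈)
    }
    where
    toward : ∀ {i} → i ∈ˢ S ∪ˢ S′ → Controls (λ z → R z × R′ z) i h
    toward i∈ with x∈p∪q⁻ S S′ i∈
    ... | inj₁ i∈S  = Controls-⊆ (λ _ → proj₁) (controls β i∈S h∈S)
    ... | inj₂ i∈S′ = Controls-⊆ (λ _ → proj₂) (controls β′ i∈S′ h∈S′)
    away : ∀ {i} → i ∈ˢ S ∪ˢ S′ → Controls (λ z → R z × R′ z) h i
    away i∈ with x∈p∪q⁻ S S′ i∈
    ... | inj₁ i∈S  = Controls-⊆ (λ _ → proj₁) (controls β h∈S i∈S)
    ... | inj₂ i∈S′ = Controls-⊆ (λ _ → proj₂) (controls β′ h∈S′ i∈S′)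

  evals-var : (ρ : Fin k → Fin n) (v : Vec A n) → evals C (tabulate (var ∘ ρ)) v ≡ tabulate (lookup v ∘ ρ)
  evals-var {zero}  ρ v = refl
  evals-var {suc k} ρ v = cong (lookup v (ρ zero) ∷_) (evals-var (ρ ∘ suc) v)

  -- The inactive coordinates are identified with an active one, which makes
  -- the set a curve in all of its coordinates.
  qf-balanced : ∀ {S} {R : Vec A n → Set ℓ} → Balanced S R → QF R
  qf-balanced {n} {S} {R} β with nonempty? S
  -- Without active coordinates `R` is everything or nothing. This includes arity zero, which no
  -- curve relation has.
  ... | no empty with em {∃[ v ] R v}
  ...   | yes (u , Ru) = qf-⊤ λ v → local β (λ i i∈S → ⊥-elim (empty (i , i∈S))) Ru
  ...   | no  none     = qf-⊥ λ v Rv → none (v , Rv)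
  qf-balanced {n} {S} {R} β | yes (h , h∈S) = rel curve (tabulate (var ∘ ρ)) , _ , λ v → mk⇔ (⇒ v) (⇐ v)
    where
    ρ : Fin n → Fin n
    ρ i with i ∈? S
    ... | yes _ = i
    ... | no  _ = h
    ρ∈S : ∀ i → ρ i ∈ˢ S
    ρ∈S i with i ∈? S
    ... | yes i∈S = i∈S
    ... | no  _   = h∈S
    ρ-id : ∀ i → i ∈ˢ S → ρ i ≡ i
    ρ-id i i∈S with i ∈? S
    ... | yes _  = refl
    ... | no i∉S = ⊥-elim (i∉S i∈S)
    X : Vec A n → Set ℓ
    X w = R w × (∀ l → lookup w l ≡ lookup w (ρ l))
    X-def : Def X
    X-def = def-∧ (definition β) (def-⋀ λ l → def-≡ l (ρ l))
    open Def X-def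
    1≤ : ∀ {n} → Fin n → 1 ≤ n
    1≤ {suc n} _ = s≤s z≤n
    curve : AclCurve M̃ n
    curve = record
      { positiveArity = 1≤ h
      ; set           = set
      ; overAcl∅      = over
      ; isCurve       = controlled-curve set λ i j a → Finite-⊆
          (λ { y (z , z∈X , refl , refl) → let Rz , eq = from (sat z) z∈X in z , Rz , sym (eq i) , sym (eq j) })
          (controls β (ρ∈S i) (ρ∈S j) a)
      }
    ⇒ : ∀ v → R v → points M set (evals C (tabulate (var ∘ ρ)) v)
    ⇒ v Rv = subst (points M set) (sym (evals-var ρ v)) (to (sat (tabulate (lookup v ∘ ρ)))
      ( local β (λ i i∈S → sym (trans (lookup∘tabulate (lookup v ∘ ρ) i) (cong (lookup v) (ρ-id i i∈S)))) Rv
      , λ l → trans (lookup∘tabulate (lookup v ∘ ρ) l)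
                (trans (cong (lookup v) (sym (ρ-id (ρ l) (ρ∈S l)))) (sym (lookup∘tabulate (lookup v ∘ ρ) (ρ l))))))
    ⇐ : ∀ v → points M set (evals C (tabulate (var ∘ ρ)) v) → R v
    ⇐ v s = local β (λ i i∈S → trans (lookup∘tabulate (lookup v ∘ ρ) i) (cong (lookup v) (ρ-id i i∈S)))
      (proj₁ (from (sat (tabulate (lookup v ∘ ρ))) (subst (points M set) (evals-var ρ v) s)))

  -- Links: balanced sets with finite fibres in the quantified variable

  record Link (R : Vec A (suc n) → Set ℓ) : Set ℓ where
    field
      support  : Subset (suc n)
      balanced : Balanced support R
      zero∈    : zero ∈ˢ support
      finite   : ∀ v → Finite (λ x → R (x ∷ v))

  open Link

  record Unary (U : Vec A (suc n) → Set ℓ) : Set ℓ where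
    field
      definition : Def U
      constant   : ∀ {x v w} → U (x ∷ v) → U (x ∷ w)

  qf-link : {R : Vec A (suc n) → Set ℓ} → Link R → QF (λ v → ∃[ x ] R (x ∷ v))
  qf-link λR with support λR | balanced λR
  ... | _ ∷ _ | β = qf-balanced (balanced-∃ β)

  link-∧ : {R R′ : Vec A (suc n) → Set ℓ} → Link R → Link R′ → Link (λ z → R z × R′ z)
  link-∧ λR λR′ = record
    { balanced = balanced-∧ (zero∈ λR) (zero∈ λR′) (balanced λR) (balanced λR′)
    ; zero∈    = x∈p∪q⁺ (inj₁ (zero∈ λR))
    ; finite   = λ v → Finite-⊆ (λ _ → proj₁) (finite λR v)
    }

  -- `U` reads only coordinate zero, which is already active in `R`, so the support does not grow.
  link-unary : {R U : Vec A (suc n) → Set ℓ} → Link R → Unary U → Link (λ z → R z × U z)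
  link-unary {R = R} {U} λR υ = record
    { balanced = record
      { definition = def-∧ (definition (balanced λR)) (Unary.definition υ)
      ; local      = λ {u} {v} agree (Ru , Uu) → local (balanced λR) agree Ru , U-local u v (agree zero (zero∈ λR)) Uu
      ; controls   = λ i∈ j∈ → Controls-⊆ (λ _ → proj₁) (controls (balanced λR) i∈ j∈)
      }
    ; zero∈  = zero∈ λR
    ; finite = λ v → Finite-⊆ (λ _ → proj₁) (finite λR v)
    }
    where
    U-local : ∀ u v → lookup u zero ≡ lookup v zero → U u → U v
    U-local (x ∷ u) (.x ∷ v) refl = Unary.constant υ

  -- With zero as the only active coordinate the fibre does not depend on `v`, so a single fibre
  -- bounds the union. The carrier may be empty, hence the search for some `u`.
  link-bounded : {R : Vec A (suc n) → Set ℓ} (λR : Link R) → (∀ t → ¬ (suc t ∈ˢ support λR)) →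
    Finite (λ x → ∃[ v ] R (x ∷ v))
  link-bounded {n} λR alone with em {Vec A n}
  ... | no  none = Finite-list [] λ { x (v , _) → ⊥-elim (none v) }
  ... | yes u    = Finite-⊆ (λ { x (v , Rv) →
                     local (balanced λR) (λ { zero _ → refl ; (suc t) t∈ → ⊥-elim (alone t t∈) }) Rv }) (finite λR u)

  -- R ∖ R′ need not be balanced, as the variables of R′ are unconstrained by it;
  -- once R and R′ have a common point above v, that point ties them to those of R.
  link-∖ : {R R′ : Vec A (suc n) → Set ℓ} → Link R → Link R′ →
    Link (λ z → R z × ¬ R′ z × ∃[ x ] (R (x ∷ tail z) × R′ (x ∷ tail z)))
  link-∖ {n} {R} {R′} λR λR′ = record
    { balanced = record
      { definition = def-∧ (definition β) (def-∧ (def-¬ (definition β′))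
                       (def-map tail suc (λ { (_ ∷ _) _ → refl }) (def-∃ (def-∧ (definition β) (definition β′)))))
      ; local      = λ {u} {v} → local′ u v
      ; controls   = λ {i} {j} i∈ j∈ a → Finite-⊆
                       (λ { y (z@(x ∷ v) , (Rz , _ , x′ , Rx′ , R′x′) , e) → x′ ∷ z , (Rz , Rx′ , R′x′) , e })
                       (Controls-trans (proj₁ (hub i i∈)) (proj₂ (hub j j∈)) a)
      }
    ; zero∈  = x∈p∪q⁺ {q = S′} (inj₁ (zero∈ λR))
    ; finite = λ v → Finite-⊆ (λ _ → proj₁) (finite λR v)
    }
    where
    S S′ : Subset (suc n)
    S  = support λR
    S′ = support λR′
    β : Balanced S R
    β = balanced λR
    β′ : Balanced S′ R′
    β′ = balanced λR′
    local′ : ∀ u v → (∀ i → i ∈ˢ S ∪ˢ S′ → lookup u i ≡ lookup v i) →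
      R u × ¬ R′ u × ∃[ x ] (R (x ∷ tail u) × R′ (x ∷ tail u)) →
      R v × ¬ R′ v × ∃[ x ] (R (x ∷ tail v) × R′ (x ∷ tail v))
    local′ (_ ∷ _) (_ ∷ _) agree (Ru , ¬R′u , x , Rx , R′x) =
      local β (λ i i∈ → agree i (x∈p∪q⁺ (inj₁ i∈))) Ru ,
      (λ R′v → ¬R′u (local β′ (λ i i∈ → sym (agree i (x∈p∪q⁺ (inj₂ i∈)))) R′v)) ,
      x ,
      local β (λ { zero _ → refl ; (suc i) i∈ → agree (suc i) (x∈p∪q⁺ (inj₁ i∈)) }) Rx ,
      local β′ (λ { zero _ → refl ; (suc i) i∈ → agree (suc i) (x∈p∪q⁺ (inj₂ i∈)) }) R′x
    second : Vec A (2 + n) → Vec A (suc n)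
    second (x′ ∷ _ ∷ v) = x′ ∷ v
    -- Making the common point an explicit coordinate `x′` gives a set `W` in the variables
    -- `x′ , x , v`, within which controls can be chained.
    W : Vec A (2 + n) → Set ℓ
    W w = R (tail w) × R (second w) × R′ (second w)
    tail-lookup : ∀ i (w : Vec A (2 + n)) → lookup (tail w) i ≡ lookup w (suc i)
    tail-lookup i (_ ∷ _) = refl
    second-zero : ∀ w → lookup (second w) zero ≡ lookup w zero
    second-zero (_ ∷ _ ∷ _) = refl
    second-suc : ∀ t w → lookup (second w) (suc t) ≡ lookup w (suc (suc t))
    second-suc t (_ ∷ _ ∷ _) = refl
    anchored : ∀ {t} → suc t ∈ˢ S → Controls W (suc (suc t)) zero × Controls W zero (suc (suc t))
    anchored {t} t∈ =
      Controls-map second (λ _ → proj₁ ∘ proj₂) (second-suc t) second-zero (controls β t∈ (zero∈ λR)) ,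
      Controls-map second (λ _ → proj₁ ∘ proj₂) second-zero (second-suc t) (controls β (zero∈ λR) t∈)
    bounded : (∀ t → ¬ (suc t ∈ˢ S)) → Controls W (suc zero) zero × Controls W zero (suc zero)
    bounded alone =
      (λ _ → Finite-⊆ (λ { y ((_ ∷ _ ∷ v) , (_ , Rx′ , _) , _ , refl) → v , Rx′ }) (link-bounded λR alone)) ,
      (λ _ → Finite-⊆ (λ { y ((_ ∷ _ ∷ v) , (Rx , _) , _ , refl) → v , Rx }) (link-bounded λR alone))
    -- Every active coordinate is tied to `x′` in both directions: those of `v` directly, through
    -- `R` or `R′` at `x′`, and `x` through some coordinate of `v` active in `R`. If `R` has no such
    -- coordinate, `x` and `x′` both range over one finite set.
    hub : ∀ i → i ∈ˢ S ∪ˢ S′ → Controls W (suc i) zero × Controls W zero (suc i)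
    hub zero _ with any? (λ t → suc t ∈? S)
    ... | no  alone    = bounded λ t t∈ → alone (t , t∈)
    ... | yes (t , t∈) =
      Controls-trans (Controls-map tail (λ _ → proj₁) (tail-lookup zero) (tail-lookup (suc t)) (controls β (zero∈ λR) t∈))
                     (proj₁ (anchored t∈)) ,
      Controls-trans (proj₂ (anchored t∈))
                     (Controls-map tail (λ _ → proj₁) (tail-lookup (suc t)) (tail-lookup zero) (controls β t∈ (zero∈ λR)))
    hub (suc t) t∈ with x∈p∪q⁻ S S′ t∈
    ... | inj₁ t∈S  = anchored t∈S
    ... | inj₂ t∈S′ =
      Controls-map second (λ _ → proj₂ ∘ proj₂) (second-suc t) second-zero (controls β′ t∈S′ (zero∈ λR′)) ,
      Controls-map second (λ _ → proj₂ ∘ proj₂) second-zero (second-suc t) (controls β′ (zero∈ λR′) t∈S′)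

  -- Finite unions of cells

  data FinUnion (𝓒 : (Vec A n → Set ℓ) → Set (lsuc ℓ)) : (Vec A n → Set ℓ) → Set (lsuc ℓ) where
    none : ∀ {P} → (∀ z → ¬ P z) → FinUnion 𝓒 P
    one  : ∀ {P} → 𝓒 P → FinUnion 𝓒 P
    both : ∀ {P Q T} → FinUnion 𝓒 P → FinUnion 𝓒 Q → (∀ z → T z ⇔ (P z ⊎ Q z)) → FinUnion 𝓒 T

  module _ {𝓒 : (Vec A n → Set ℓ) → Set (lsuc ℓ)} where

    -- Of the constructors only `both` carries an equivalence, so an empty summand is adjoined.
    union-cong : ∀ {P Q} → (∀ z → Q z ⇔ P z) → FinUnion 𝓒 P → FinUnion 𝓒 Q
    union-cong e u = both u (none {P = λ _ → ⊥ℓ} λ _ ())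
      λ z → mk⇔ (inj₁ ∘ to (e z)) λ { (inj₁ p) → from (e z) p ; (inj₂ ()) }

    union-∨ : ∀ {P Q} → FinUnion 𝓒 P → FinUnion 𝓒 Q → FinUnion 𝓒 (λ z → P z ⊎ Q z)
    union-∨ u u′ = both u u′ λ _ → ⇔-id _

    union-∧ : ∀ {P} {Q : Vec A n → Set ℓ} → (∀ {P} → 𝓒 P → FinUnion 𝓒 (λ z → P z × Q z)) → FinUnion 𝓒 P → FinUnion 𝓒 (λ z → P z × Q z)
    union-∧ f (none ¬P)     = none λ z (p , _) → ¬P z p
    union-∧ f (one c)       = f c
    union-∧ f (both u u′ e) = both (union-∧ f u) (union-∧ f u′) λ z → mk⇔
      (λ (t , q) → Sum.map (_, q) (_, q) (to (e z) t))
      (λ { (inj₁ (p , q)) → from (e z) (inj₁ p) , q ; (inj₂ (p , q)) → from (e z) (inj₂ p) , q })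

  qf-union : {𝓒 : (Vec A (suc n) → Set ℓ) → Set (lsuc ℓ)} →
    (∀ {P} → 𝓒 P → QF (λ v → ∃[ x ] P (x ∷ v))) → ∀ {P} → FinUnion 𝓒 P → QF (λ v → ∃[ x ] P (x ∷ v))
  qf-union f (none ¬P)     = qf-⊥ λ { v (x , p) → ¬P _ p }
  qf-union f (one c)       = f c
  qf-union f (both u u′ e) = qf-cong (λ v → mk⇔
      (λ (x , t) → Sum.map (x ,_) (x ,_) (to (e (x ∷ v)) t))
      (λ { (inj₁ (x , p)) → x , from (e (x ∷ v)) (inj₁ p) ; (inj₂ (x , q)) → x , from (e (x ∷ v)) (inj₂ q) }))
    (qf-∨ (qf-union f u) (qf-union f u′))

  record Cell (𝓑 : (Vec A (suc n) → Set ℓ) → Set ℓ) (P : Vec A (suc n) → Set ℓ) : Set (lsuc ℓ) where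
    constructor cell
    field
      {condition} : Vec A n → Set ℓ
      {base}      : Vec A (suc n) → Set ℓ
      qf          : QF condition
      isBase      : 𝓑 base
      split       : ∀ x v → P (x ∷ v) ⇔ (condition v × base (x ∷ v))

  InfUnary : (Vec A (suc n) → Set ℓ) → Set ℓ
  InfUnary U = Unary U × (∀ v → Infinite (λ x → U (x ∷ v)))

  cells-∧-cond : {𝓑 : (Vec A (suc n) → Set ℓ) → Set ℓ} {P : Vec A (suc n) → Set ℓ} {S : Vec A n → Set ℓ} →
    QF S → FinUnion (Cell 𝓑) P → FinUnion (Cell 𝓑) (λ z → P z × S (tail z))
  cells-∧-cond qfS = union-∧ λ { (cell qf b e) → one (cell (qf-∧ qf qfS) b λ x v → mk⇔
    (λ (p , s) → let c , r = to (e x v) p in (c , s) , r) (λ ((c , s) , r) → from (e x v) (c , r) , s)) }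

  cells-∧-base : {𝓑 : (Vec A (suc n) → Set ℓ) → Set ℓ} {P Q : Vec A (suc n) → Set ℓ} →
    (∀ {R} → 𝓑 R → 𝓑 (λ z → R z × Q z)) → FinUnion (Cell 𝓑) P → FinUnion (Cell 𝓑) (λ z → P z × Q z)
  cells-∧-base combine = union-∧ λ { (cell qf b e) → one (cell qf (combine b) λ x v → mk⇔
    (λ (p , q) → let c , r = to (e x v) p in c , r , q) (λ (c , r , q) → from (e x v) (c , r) , q)) }

  -- `Pos` sets have finite fibres over `v` and serve for the exceptional points; `Gen` sets
  -- describe what happens away from these.
  Pos Gen : (Vec A (suc n) → Set ℓ) → Set (lsuc ℓ)
  Pos = FinUnion (Cell Link)
  Gen = FinUnion (Cell Unary)

  unary-∧ : {U U′ : Vec A (suc n) → Set ℓ} → Unary U → Unary U′ → Unary (λ z → U z × U′ z)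
  unary-∧ υ υ′ = record
    { definition = def-∧ (Unary.definition υ) (Unary.definition υ′)
    ; constant   = λ (p , q) → Unary.constant υ p , Unary.constant υ′ q }

  unary-¬ : {U : Vec A (suc n) → Set ℓ} → Unary U → Unary (λ z → ¬ U z)
  unary-¬ υ = record
    { definition = def-¬ (Unary.definition υ)
    ; constant   = λ ¬p q → ¬p (Unary.constant υ q) }

  unary-⊤ : {U : Vec A (suc n) → Set ℓ} → (∀ z → U z) → Unary U
  unary-⊤ p = record { definition = def-⊤ p ; constant = λ _ → p _ }

  gen-∧ : {P Q : Vec A (suc n) → Set ℓ} → Gen P → Gen Q → Gen (λ z → P z × Q z)
  gen-∧ g (none ¬Q) = none λ z (_ , q) → ¬Q z q
  gen-∧ g (one (cell qf υ e)) = union-cong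
    (λ { (x ∷ v) → mk⇔ (λ (p , q) → let c , u = to (e x v) q in (p , c) , u) (λ ((p , c) , u) → p , from (e x v) (c , u)) })
    (cells-∧-base (λ υ′ → unary-∧ υ′ υ) (cells-∧-cond qf g))
  gen-∧ g (both h h′ e) = both (gen-∧ g h) (gen-∧ g h′) λ z → mk⇔
    (λ (p , t) → Sum.map (p ,_) (p ,_) (to (e z) t))
    (λ { (inj₁ (p , q)) → p , from (e z) (inj₁ q) ; (inj₂ (p , q)) → p , from (e z) (inj₂ q) })

  ⊤ᴾ : Vec A n → Set ℓ
  ⊤ᴾ _ = ⊤

  gen-¬ : {P : Vec A (suc n) → Set ℓ} → Gen P → Gen (λ z → ¬ P z)
  gen-¬ (none ¬P) = one (cell (qf-⊤ {P = ⊤ᴾ} _) (unary-⊤ {U = ⊤ᴾ} _) λ x v → mk⇔ _ (λ _ → ¬P (x ∷ v)))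
  gen-¬ {n} {P} (one (cell {c} {U} qf υ e)) = both
    (one {P = λ z → ¬ c (tail z)} (cell (qf-¬ qf) (unary-⊤ {U = ⊤ᴾ} _) λ x v → mk⇔ (_, _) proj₁))
    (one {P = λ z → ¬ U z} (cell (qf-⊤ {P = ⊤ᴾ} _) (unary-¬ υ) λ x v → mk⇔ (_ ,_) proj₂))
    λ { (x ∷ v) → mk⇔ (deMorgan x v) λ { (inj₁ ¬c) p → ¬c (proj₁ (to (e x v) p)) ; (inj₂ ¬u) p → ¬u (proj₂ (to (e x v) p)) } }
    where
    deMorgan : ∀ x v → ¬ P (x ∷ v) → ¬ c v ⊎ ¬ U (x ∷ v)
    deMorgan x v ¬p with em {c v}
    ... | yes s = inj₂ λ u → ¬p (from (e x v) (s , u))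
    ... | no ¬s = inj₁ ¬s
  gen-¬ (both g g′ e) = union-cong (λ z → mk⇔ (λ ¬t → ¬t ∘ from (e z) ∘ inj₁ , ¬t ∘ from (e z) ∘ inj₂)
      (λ (¬p , ¬q) → [ ¬p , ¬q ]′ ∘ to (e z)))
    (gen-∧ (gen-¬ g) (gen-¬ g′))

  -- Whether `R` and `R′` meet above `v` is quantifier free, since their intersection is a link.
  -- Where they meet, `link-∖` applies; elsewhere nothing is removed from `R`.
  pos-∖-link : {P R′ : Vec A (suc n) → Set ℓ} → Link R′ → Pos P → Pos (λ z → P z × ¬ R′ z)
  pos-∖-link {R′ = R′} λR′ = union-∧ λ { {P} (cell {c} {R} qf λR e) →
    let meets : Vec A _ → Set ℓ
        meets v = ∃[ x ] (R (x ∷ v) × R′ (x ∷ v))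
    in both
      (one {P = λ z → c (tail z) × (R z × ¬ R′ z × meets (tail z))} (cell qf (link-∖ λR λR′) λ x v → ⇔-id _))
      (one {P = λ z → (c (tail z) × ¬ meets (tail z)) × R z}
        (cell (qf-∧ qf (qf-¬ (qf-link (link-∧ λR λR′)))) λR λ x v → ⇔-id _))
      λ { (x ∷ v) → mk⇔
        (λ (p , ¬r′) → let s , r = to (e x v) p in
          [ (λ y → inj₁ (s , r , ¬r′ , y)) , (λ ¬y → inj₂ ((s , ¬y) , r)) ]′ (toSum (em {meets v})))
        (λ { (inj₁ (s , r , ¬r′ , _)) → from (e x v) (s , r) , ¬r′
           ; (inj₂ ((s , ¬y) , r)) → from (e x v) (s , r) , λ r′ → ¬y (x , r , r′) }) } }

  pos-finite : {P : Vec A (suc n) → Set ℓ} → Pos P → ∀ v → Finite (λ x → P (x ∷ v))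
  pos-finite (none ¬P) v = Finite-list [] λ x p → ⊥-elim (¬P _ p)
  pos-finite (one (cell _ λR e)) v = Finite-⊆ (λ x p → proj₂ (to (e x v) p)) (finite λR v)
  pos-finite (both u u′ e) v = Finite-⊆ (λ x → to (e (x ∷ v))) (Finite-∪ (pos-finite u v) (pos-finite u′ v))

  -- The stability fields inter and diff make tameness pass to Boolean combinations
  -- directly, without a disjunctive normal form.
  record Tame (Q : Vec A (suc n) → Set ℓ) : Set (lsuc ℓ) where
    field
      {exception generic-part} : Vec A (suc n) → Set ℓ
      exceptional : Pos exception
      gen         : Gen generic-part
      agree       : ∀ z → ¬ exception z → Q z ⇔ generic-part z
      inter       : ∀ {P} → Pos P → Pos (λ z → P z × Q z)
      diff        : ∀ {P} → Pos P → Pos (λ z → P z × ¬ Q z)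

  open Tame

  -- Closure of tame sets under Boolean operations

  tame-cong : {P Q : Vec A (suc n) → Set ℓ} → (∀ z → Q z ⇔ P z) → Tame P → Tame Q
  tame-cong e τ = record
    { exceptional = exceptional τ
    ; gen         = gen τ
    ; agree       = λ z ¬x → agree τ z ¬x ⇔-∘ e z
    ; inter       = λ π → union-cong (λ z → mk⇔ (λ (p , q) → p , to (e z) q) (λ (p , q) → p , from (e z) q)) (inter τ π)
    ; diff        = λ π → union-cong (λ z → mk⇔ (λ (p , q) → p , q ∘ from (e z)) (λ (p , q) → p , q ∘ to (e z))) (diff τ π)
    }

  tame-¬ : {Q : Vec A (suc n) → Set ℓ} → Tame Q → Tame (λ z → ¬ Q z)
  tame-¬ τ = record
    { exceptional = exceptional τ
    ; gen         = gen-¬ (gen τ)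
    ; agree       = λ z ¬x → mk⇔ (_∘ from (agree τ z ¬x)) (_∘ to (agree τ z ¬x))
    ; inter       = diff τ
    ; diff        = λ π → union-cong (λ z → mk⇔ (λ (p , ¬¬q) → p , ¬¬-elim em ¬¬q) (λ (p , q) → p , λ ¬q → ¬q q)) (inter τ π)
    }

  tame-∧ : {Q Q′ : Vec A (suc n) → Set ℓ} → Tame Q → Tame Q′ → Tame (λ z → Q z × Q′ z)
  tame-∧ {Q = Q} τ τ′ = record
    { exceptional = union-∨ (exceptional τ) (exceptional τ′)
    ; gen         = gen-∧ (gen τ) (gen τ′)
    ; agree       = λ z ¬x → let e = agree τ z (¬x ∘ inj₁) ; e′ = agree τ′ z (¬x ∘ inj₂) in
                      mk⇔ (λ (q , q′) → to e q , to e′ q′) (λ (g , g′) → from e g , from e′ g′)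
    ; inter       = λ π → union-cong (λ z → mk⇔ (λ (p , q , q′) → (p , q) , q′) (λ ((p , q) , q′) → p , q , q′))
                      (inter τ′ (inter τ π))
    ; diff        = λ π → both (diff τ π) (diff τ′ (inter τ π)) λ z → mk⇔
                      (λ (p , ¬qq′) → [ (λ q → inj₂ ((p , q) , λ q′ → ¬qq′ (q , q′))) , (λ ¬q → inj₁ (p , ¬q)) ]′ (toSum (em {Q z})))
                      (λ { (inj₁ (p , ¬q)) → p , ¬q ∘ proj₁ ; (inj₂ ((p , q) , ¬q′)) → p , ¬q′ ∘ proj₂ })
    }

  tame-∨ : {Q Q′ : Vec A (suc n) → Set ℓ} → Tame Q → Tame Q′ → Tame (λ z → Q z ⊎ Q′ z)
  tame-∨ τ τ′ = tame-cong
    (λ z → mk⇔ (λ { (inj₁ q) (¬q , _) → ¬q q ; (inj₂ q′) (_ , ¬q′) → ¬q′ q′ })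
               (λ f → ¬¬-elim em λ ¬qq′ → f (¬qq′ ∘ inj₁ , ¬qq′ ∘ inj₂)))
    (tame-¬ (tame-∧ (tame-¬ τ) (tame-¬ τ′)))

  tame-⇒ : {Q Q′ : Vec A (suc n) → Set ℓ} → Tame Q → Tame Q′ → Tame (λ z → Q z → Q′ z)
  tame-⇒ τ τ′ = tame-cong
    (λ z → mk⇔ (λ f (q , ¬q′) → ¬q′ (f q)) (λ f q → ¬¬-elim em λ ¬q′ → f (q , ¬q′)))
    (tame-¬ (tame-∧ τ (tame-¬ τ′)))

  tame-⊥ : {Q : Vec A (suc n) → Set ℓ} → (∀ z → ¬ Q z) → Tame Q
  tame-⊥ ¬Q = record
    { exceptional = none {P = λ _ → ⊥ℓ} λ _ ()
    ; gen         = none ¬Q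
    ; agree       = λ z _ → ⇔-id _
    ; inter       = λ π → none λ z (_ , q) → ¬Q z q
    ; diff        = λ π → union-cong (λ z → mk⇔ proj₁ (λ p → p , ¬Q z)) π
    }

  -- Basic tame sets and finite unions

  tame-cond : {S : Vec A n → Set ℓ} → QF S → Tame (λ z → S (tail z))
  tame-cond qf = record
    { exceptional = none {P = λ _ → ⊥ℓ} λ _ ()
    ; gen         = one (cell qf (unary-⊤ {U = ⊤ᴾ} _) λ x v → mk⇔ (_, _) proj₁)
    ; agree       = λ z _ → ⇔-id _
    ; inter       = cells-∧-cond qf
    ; diff        = cells-∧-cond (qf-¬ qf)
    }

  tame-unary : {U : Vec A (suc n) → Set ℓ} → Unary U → Tame U
  tame-unary υ = record
    { exceptional = none {P = λ _ → ⊥ℓ} λ _ ()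
    ; gen         = one (cell (qf-⊤ {P = ⊤ᴾ} _) υ λ x v → mk⇔ (_ ,_) proj₂)
    ; agree       = λ z _ → ⇔-id _
    ; inter       = cells-∧-base (λ λR → link-unary λR υ)
    ; diff        = cells-∧-base (λ λR → link-unary λR (unary-¬ υ))
    }

  -- A link serves as its own exceptional set, away from which it is empty.
  tame-link : {R : Vec A (suc n) → Set ℓ} → Link R → Tame R
  tame-link λR = record
    { exceptional = one (cell (qf-⊤ {P = ⊤ᴾ} _) λR λ x v → mk⇔ (_ ,_) proj₂)
    ; gen         = none {P = λ _ → ⊥ℓ} λ _ ()
    ; agree       = λ z ¬r → mk⇔ (λ r → ⊥-elim (¬r r)) λ ()
    ; inter       = cells-∧-base (λ λR′ → link-∧ λR′ λR)
    ; diff        = pos-∖-link λR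
    }

  -- If `x` is inactive, the set is a condition on `v`; if another coordinate is active along with
  -- `x`, it controls `x` and the set is a link; if `x` alone is active, the set is unary.
  tame-balanced : ∀ {S} {R : Vec A (suc n) → Set ℓ} → Balanced S R → Tame R
  tame-balanced {S = outside ∷ S} {R} β = tame-cong
    (λ { (x ∷ v) → mk⇔ (x ,_) λ (_ , Rv) → local β (λ { (suc i) _ → refl }) Rv })
    (tame-cond (qf-balanced (balanced-∃ β)))
  tame-balanced {S = inside ∷ S} β with nonempty? S
  ... | yes (t , t∈) = tame-link record
    { balanced = β
    ; zero∈    = Vec.here
    ; finite   = λ v → Finite-⊆ (λ x Rx → x ∷ v , Rx , refl , refl) (controls β (Vec.there t∈) Vec.here (lookup v t))
    }
  ... | no empty = tame-unary record
    { definition = definition β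
    ; constant   = local β λ { zero _ → refl ; (suc i) (Vec.there i∈) → ⊥-elim (empty (i , i∈)) }
    }

  tame-⋃-Fin : {P : Fin k → Vec A (suc n) → Set ℓ} → (∀ i → Tame (P i)) → Tame (λ z → ∃[ i ] P i z)
  tame-⋃-Fin {zero}  τ = tame-⊥ λ { z (() , _) }
  tame-⋃-Fin {suc k} τ = tame-cong (λ z → mk⇔ (λ { (zero , p) → inj₁ p ; (suc i , p) → inj₂ (i , p) })
      (λ { (inj₁ p) → zero , p ; (inj₂ (i , p)) → suc i , p }))
    (tame-∨ (τ zero) (tame-⋃-Fin (τ ∘ suc)))

  tame-⋃-Finite : {T : A → Set ℓ} {P : A → Vec A (suc n) → Set ℓ} → Finite T → (∀ c → T c → Tame (P c)) →
    Tame (λ z → ∃[ c ] T c × P c z)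
  tame-⋃-Finite {n} {T} {P} (_ , xs , _ , cov) τ =
    tame-cong (λ z → mk⇔ (λ (c , t , p) → c , cov c t , t , p) (λ (c , _ , t , p) → c , t , p)) (go xs)
    where
    go : ∀ xs → Tame (λ z → ∃[ c ] c ∈ˡ xs × T c × P c z)
    go [] = tame-⊥ λ { z (c , () , _) }
    go (x ∷ xs) with em {T x}
    ... | no ¬t = tame-cong (λ z → mk⇔ (λ { (c , here refl , t , _) → ⊥-elim (¬t t) ; (c , there c∈ , r) → c , c∈ , r })
                    (λ (c , c∈ , r) → c , there c∈ , r)) (go xs)
    ... | yes t = tame-cong (λ z → mk⇔ (λ { (c , here refl , _ , p) → inj₁ p ; (c , there c∈ , r) → inj₂ (c , c∈ , r) })
                    (λ { (inj₁ p) → x , here refl , t , p ; (inj₂ (c , c∈ , r)) → c , there c∈ , r }))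
                    (tame-∨ (τ x t) (go xs))

  -- Curves are Boolean combinations of balanced sets

  balanced-point : ∀ {c} → acl M ∅ c → (i : Fin n) → Balanced ⁅ i ⁆ (λ z → c ≡ lookup z i)
  balanced-point c∈acl i = record
    { definition = def-const c∈acl (def-≡ zero (suc i))
    ; local      = λ agree e → trans e (agree i (x∈⁅x⁆ i))
    ; controls   = λ p q a → singleton (x∈⁅y⁆⇒x≡y i p) (x∈⁅y⁆⇒x≡y i q) a
    }
    where
    singleton : ∀ {j l c} → j ≡ i → l ≡ i → Controls (λ z → c ≡ lookup z i) j l
    singleton refl refl a = Finite-list (a ∷ []) λ { y (_ , _ , refl , refl) → here refl }

  -- This is what `curve-thin` yields for a curve, asked of active coordinates only, so that
  -- variables absent from an atomic formula stay free.
  Thin : Subset n → (Vec A n → Set ℓ) → Set ℓ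
  Thin S R = ∀ {i j} → i ∈ˢ S → j ∈ˢ S → Finite (λ a → Infinite (Slice R i j a))

  -- The new value is first a free extra coordinate, introduced by a renaming, and is then fixed to
  -- the parameter `c`.
  def-update : {R : Vec A n → Set ℓ} (i : Fin n) {c : A} → acl M ∅ c → Def R → Def (λ z → R (z [ i ]≔ c))
  def-update {n} i c∈acl d = def-const c∈acl (def-map f ρ eq d)
    where
    f : Vec A (suc n) → Vec A n
    f (y ∷ z) = z [ i ]≔ y
    ρ : Fin n → Fin (suc n)
    ρ l with l ≟ᶠ i
    ... | yes _ = zero
    ... | no  _ = suc l
    eq : ∀ v l → lookup (f v) l ≡ lookup v (ρ l)
    eq (y ∷ z) l with l ≟ᶠ i
    ... | yes refl = lookup∘update i z y
    ... | no  l≢i  = lookup∘update′ l≢i z y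

  ∉-self : ∀ (S : Subset n) i → ¬ (i ∈ˢ S -ˢ i)
  ∉-self (_ ∷ S) zero    ()
  ∉-self (_ ∷ S) (suc i) (Vec.there i∈) = ∉-self S i i∈

  -- Outside the finitely many exceptional values a thin set is balanced, and fixing
  -- a coordinate to an exceptional value, which lies in acl(∅), deactivates it.
  tame-thin : ∀ k (S : Subset (suc n)) {R : Vec A (suc n) → Set ℓ} → ∣ S ∣ < k →
    Def R → Local S R → Thin S R → Tame R
  -- The recursion is on `k`, a strict bound on the number of active coordinates; each special piece
  -- loses one of them.
  tame-thin {n} (suc k) S {R} (s≤s ∣S∣≤k) d loc thin = tame-cong equivalent
    (tame-∨ (tame-balanced {S = S} regular) (tame-⋃-Fin λ i → tame-⋃-Fin λ j → special i j))
    where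
    Exc : Fin (suc n) → Fin (suc n) → A → Set ℓ
    Exc i j a = (i ∈ˢ S × j ∈ˢ S) × Infinite (Slice R i j a)
    Regular : Vec A (suc n) → Set ℓ
    Regular z = R z × (∀ i j → ¬ Exc i j (lookup z i))
    infinite-def : ∀ i j → Def {1} (λ u → Infinite (Slice R i j (lookup u zero)))
    infinite-def i j = def-cong (λ { (a ∷ []) → ⇔-id _ }) (def-¬ (def-Finite (def-Slice d i j)))
    exc-def : ∀ i j → Def (λ z → ¬ Exc i j (lookup z i))
    exc-def i j with i ∈? S | j ∈? S
    ... | yes i∈ | yes j∈ = def-cong (λ z → mk⇔ (λ ¬x inf → ¬x ((i∈ , j∈) , inf)) (λ ¬inf (_ , inf) → ¬inf inf))
          (def-map (λ z → lookup z i ∷ []) (λ _ → i) (λ { z zero → refl }) (def-¬ (infinite-def i j)))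
    ... | no i∉ | _ = def-⊤ λ _ ((i∈ , _) , _) → i∉ i∈
    ... | yes _ | no j∉ = def-⊤ λ _ ((_ , j∈) , _) → j∉ j∈
    regular : Balanced S Regular
    regular = record
      { definition = def-∧ d (def-⋀ λ i → def-⋀ λ j → exc-def i j)
      ; local      = λ agree (Ru , ok) → loc agree Ru , λ { i j x@((i∈ , _) , _) →
                       ok i j (subst (Exc i j) (sym (agree i i∈)) x) }
      -- An infinite slice would make `a` exceptional for `i` and `j`; no regular point takes that
      -- value, so the slice would be empty.
      ; controls   = λ {i} {j} i∈ j∈ a → ¬¬-elim em λ inf →
                       inf (Finite-list [] λ { y (z , (Rz , ok) , refl , _) →
                         ⊥-elim (ok i j ((i∈ , j∈) , inf ∘ Finite-⊆ λ { y (z , (Rz , _) , e) → z , Rz , e })) })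
      }
    special : ∀ i j → Tame (λ z → ∃[ c ] Exc i j c × (c ≡ lookup z i × R (z [ i ]≔ c)))
    special i j = tame-⋃-Finite finite-exc λ c ((i∈ , j∈) , inf) →
      -- The exceptional values for `i` and `j` form a finite set definable over acl(∅), so each of
      -- them lies in acl(∅).
      let c∈acl = def-acl (infinite-def i j) (thin i∈ j∈) inf in
      tame-∧ (tame-balanced (balanced-point c∈acl i))
        (tame-thin k (S -ˢ i) (≤-trans (x∈p⇒∣p-x∣<∣p∣ i∈) ∣S∣≤k) (def-update i c∈acl d)
          (λ {u} {v} agree → loc λ l l∈ → update-local u v c l l∈ agree)
          -- The update changes coordinate `i` only, so an infinite slice of the new set at other
          -- coordinates lies in an infinite slice of `R`.
          λ p q → Finite-⊆ (λ a inf′ fin → inf′ (Finite-⊆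
              (λ { y (z , Rz , refl , refl) → z [ i ]≔ c , Rz , lookup∘update′ (≢i p) z c , lookup∘update′ (≢i q) z c }) fin))
            (thin (p─q⊆p S ⁅ i ⁆ p) (p─q⊆p S ⁅ i ⁆ q)))
      where
      finite-exc : Finite (Exc i j)
      finite-exc with i ∈? S | j ∈? S
      ... | yes i∈ | yes j∈ = Finite-⊆ (λ _ → proj₂) (thin i∈ j∈)
      ... | no i∉ | _ = Finite-list [] λ _ ((i∈ , _) , _) → ⊥-elim (i∉ i∈)
      ... | yes _ | no j∉ = Finite-list [] λ _ ((_ , j∈) , _) → ⊥-elim (j∉ j∈)
      ≢i : ∀ {l} → l ∈ˢ S -ˢ i → l ≢ i
      ≢i l∈ refl = ∉-self S i l∈
      update-local : ∀ u v c l → l ∈ˢ S → (∀ l → l ∈ˢ S -ˢ i → lookup u l ≡ lookup v l) →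
        lookup (u [ i ]≔ c) l ≡ lookup (v [ i ]≔ c) l
      update-local u v c l l∈ agree with l ≟ᶠ i
      ... | yes refl = trans (lookup∘update i u c) (sym (lookup∘update i v c))
      ... | no  l≢i  = trans (lookup∘update′ l≢i u c)
                         (trans (agree l (x∈p∧x≢y⇒x∈p-y l∈ l≢i)) (sym (lookup∘update′ l≢i v c)))
    equivalent : ∀ z → R z ⇔ (Regular z ⊎ (∃[ i ] ∃[ j ] ∃[ c ] Exc i j c × (c ≡ lookup z i × R (z [ i ]≔ c))))
    equivalent z = mk⇔ ⇒ λ { (inj₁ (Rz , _)) → Rz
                           ; (inj₂ (i , _ , _ , _ , refl , Rz)) → subst R ([]≔-lookup z i) Rz }
      where
      ⇒ : R z → _
      ⇒ Rz with em {∃[ i ] ∃[ j ] Exc i j (lookup z i)}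
      ... | yes (i , j , x) = inj₂ (i , j , lookup z i , x , refl , subst R (sym ([]≔-lookup z i)) Rz)
      ... | no  ok          = inj₁ (Rz , λ i j x → ok (i , j , x))

  -- Atomic formulas: every term is a variable, as there are no function symbols

  termVar : Term (CurveLanguage M̃) n → Fin n
  termVar (var i) = i

  eval-termVar : (t : Term (CurveLanguage M̃) n) (v : Vec A n) → eval C t v ≡ lookup v (termVar t)
  eval-termVar (var i) v = refl

  lookup-evals : (ts : Vec (Term (CurveLanguage M̃) n) k) (v : Vec A n) → ∀ l →
    lookup (evals C ts v) l ≡ lookup v (termVar (lookup ts l))
  lookup-evals (t ∷ ts) v zero    = eval-termVar t v
  lookup-evals (t ∷ ts) v (suc l) = lookup-evals ts v l

  vars : Vec (Term (CurveLanguage M̃) n) k → Subset n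
  vars []       = ⊥ˢ
  vars (t ∷ ts) = ⁅ termVar t ⁆ ∪ˢ vars ts

  vars⁻ : (ts : Vec (Term (CurveLanguage M̃) n) k) {i : Fin n} → i ∈ˢ vars ts → ∃[ l ] termVar (lookup ts l) ≡ i
  vars⁻ []       i∈ = ⊥-elim (∉⊥ i∈)
  vars⁻ (t ∷ ts) i∈ with x∈p∪q⁻ ⁅ termVar t ⁆ (vars ts) i∈
  ... | inj₁ i∈t  = zero , sym (x∈⁅y⁆⇒x≡y _ i∈t)
  ... | inj₂ i∈ts = let l , e = vars⁻ ts i∈ts in suc l , e

  evals-local : (ts : Vec (Term (CurveLanguage M̃) n) k) {u v : Vec A n} →
    (∀ i → i ∈ˢ vars ts → lookup u i ≡ lookup v i) → evals C ts u ≡ evals C ts v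
  evals-local []       agree = refl
  evals-local (t ∷ ts) {u} {v} agree = cong₂ _∷_
    (trans (eval-termVar t u) (trans (agree _ (x∈p∪q⁺ (inj₁ (x∈⁅x⁆ (termVar t))))) (sym (eval-termVar t v))))
    (evals-local ts λ i i∈ → agree i (x∈p∪q⁺ (inj₂ i∈)))

  -- Every occurring variable sits at some argument position, so the thinness of the curve at its
  -- positions passes to the variables, even repeated ones.
  tame-rel : (X : AclCurve M̃ k) (ts : Vec (Term (CurveLanguage M̃) (suc n)) k) →
    Tame (λ z → C ⊨ rel X ts [ z ])
  -- `≤-refl` sets the recursion bound to one more than the number of active variables.
  tame-rel X ts = tame-thin _ (vars ts) ≤-refl
    (def-map (evals C ts) (λ l → termVar (lookup ts l)) (lookup-evals ts) (def set overAcl∅ λ _ → ⇔-id _))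
    (λ agree → subst (points M set) (evals-local ts agree))
    λ i∈ j∈ → thin (vars⁻ ts i∈) (vars⁻ ts j∈)
    where
    open AclCurve X
    thin : ∀ {i j} → ∃[ l ] termVar (lookup ts l) ≡ i → ∃[ l ] termVar (lookup ts l) ≡ j →
      Finite (λ a → Infinite (Slice (λ z → points M set (evals C ts z)) i j a))
    thin (l , refl) (l′ , refl) = Finite-⊆ (λ a inf fin → inf (Finite-⊆
        (λ { y (z , z∈ , refl , refl) → evals C ts z , z∈ , lookup-evals ts z l , lookup-evals ts z l′ }) fin))
      (curve-thin set isCurve l l′)

  balanced-≡ : (i j : Fin n) → Balanced (⁅ i ⁆ ∪ˢ ⁅ j ⁆) (λ z → lookup z i ≡ lookup z j)
  balanced-≡ {n} i j = record
    { definition = def-≡ i j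
    ; local      = λ agree e → trans (sym (agree i (x∈p∪q⁺ (inj₁ (x∈⁅x⁆ i)))))
                                 (trans e (agree j (x∈p∪q⁺ {p = ⁅ i ⁆} (inj₂ (x∈⁅x⁆ j)))))
    ; controls   = λ p q a → Finite-list (a ∷ []) λ { y (z , e , refl , refl) →
                     here (trans (value q z e) (sym (value p z e))) }
    }
    where
    value : ∀ {l} → l ∈ˢ ⁅ i ⁆ ∪ˢ ⁅ j ⁆ → ∀ (z : Vec A n) → lookup z i ≡ lookup z j → lookup z l ≡ lookup z i
    value l∈ z e with x∈p∪q⁻ ⁅ i ⁆ ⁅ j ⁆ l∈
    ... | inj₁ l∈i = cong (lookup z) (x∈⁅y⁆⇒x≡y i l∈i)
    ... | inj₂ l∈j = trans (cong (lookup z) (x∈⁅y⁆⇒x≡y j l∈j)) (sym e)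

  tame-qf : (ψ : Formula (CurveLanguage M̃) (suc n)) → QuantifierFree ψ → Tame (λ z → C ⊨ ψ [ z ])
  tame-qf ⊥′              _          = tame-⊥ λ _ ()
  tame-qf (var i ≐ var j) _          = tame-balanced (balanced-≡ i j)
  tame-qf (rel X ts)      _          = tame-rel X ts
  tame-qf (φ ∧′ ψ)        (qf , qf′) = tame-∧ (tame-qf φ qf) (tame-qf ψ qf′)
  tame-qf (φ ∨′ ψ)        (qf , qf′) = tame-∨ (tame-qf φ qf) (tame-qf ψ qf′)
  tame-qf (φ ⇒′ ψ)        (qf , qf′) = tame-⇒ (tame-qf φ qf) (tame-qf ψ qf′)

  -- Elimination of one quantifier

  Gen∞ : (Vec A (suc n) → Set ℓ) → Set (lsuc ℓ)
  Gen∞ = FinUnion (Cell InfUnary)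

  link-finite-unary : {U : Vec A (suc n) → Set ℓ} → Unary U → (∀ v → Finite (λ x → U (x ∷ v))) → Link U
  link-finite-unary {U = U} υ fin = record
    { support  = ⁅ zero ⁆
    ; balanced = record
      { definition = Unary.definition υ
      ; local      = λ { {x ∷ u} {y ∷ v} agree Uu → constant′ (agree zero (x∈⁅x⁆ zero)) Uu }
      ; controls   = λ p q a → singleton (x∈⁅y⁆⇒x≡y zero p) (x∈⁅y⁆⇒x≡y zero q) a
      }
    ; zero∈    = x∈⁅x⁆ zero
    ; finite   = fin
    }
    where
    constant′ : ∀ {x y u v} → x ≡ y → U (x ∷ u) → U (y ∷ v)
    constant′ refl = Unary.constant υ
    singleton : ∀ {i j} → i ≡ zero → j ≡ zero → Controls U i j
    singleton refl refl a = Finite-list (a ∷ []) λ { y (_ , _ , refl , refl) → here refl }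

  -- A unary set has the same fibre over every `v`. If that fibre is finite the set is a link, and
  -- its cell joins the exceptional part; the remaining cells have infinite bases.
  gen-split : {G : Vec A (suc n) → Set ℓ} → Gen G →
    Σ[ F ∈ (Vec A (suc n) → Set ℓ) ] Σ[ G∞ ∈ (Vec A (suc n) → Set ℓ) ] Pos F × Gen∞ G∞ × (∀ z → G z ⇔ (F z ⊎ G∞ z))
  gen-split (none ¬G) = (λ _ → ⊥ℓ) , (λ _ → ⊥ℓ) , none (λ _ ()) , none (λ _ ()) ,
    λ z → mk⇔ (λ g → ⊥-elim (¬G z g)) λ { (inj₁ ()) ; (inj₂ ()) }
  gen-split {G = G} (one (cell {base = U} qf υ e)) with em {∃[ v ] Finite (λ x → U (x ∷ v))}
  ... | yes (u , fin) = G , (λ _ → ⊥ℓ) ,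
          one (cell qf (link-finite-unary υ λ v → Finite-⊆ (λ x → Unary.constant υ) fin) e) , none (λ _ ()) ,
          λ z → mk⇔ inj₁ λ { (inj₁ g) → g ; (inj₂ ()) }
  ... | no inf = (λ _ → ⊥ℓ) , G , none (λ _ ()) , one (cell qf (υ , λ v fin → inf (v , fin)) e) ,
          λ z → mk⇔ inj₂ λ { (inj₁ ()) ; (inj₂ g) → g }
  gen-split (both g g′ e) with gen-split g | gen-split g′
  ... | F , H , π , γ , d | F′ , H′ , π′ , γ′ , d′ =
    (λ z → F z ⊎ F′ z) , (λ z → H z ⊎ H′ z) , union-∨ π π′ , union-∨ γ γ′ , λ z → mk⇔
      (λ t → [ Sum.map inj₁ inj₁ ∘ to (d z) , Sum.map inj₂ inj₂ ∘ to (d′ z) ]′ (to (e z) t))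
      (λ { (inj₁ (inj₁ f)) → from (e z) (inj₁ (from (d z) (inj₁ f)))
         ; (inj₁ (inj₂ f)) → from (e z) (inj₂ (from (d′ z) (inj₁ f)))
         ; (inj₂ (inj₁ h)) → from (e z) (inj₁ (from (d z) (inj₂ h)))
         ; (inj₂ (inj₂ h)) → from (e z) (inj₂ (from (d′ z) (inj₂ h))) })

  -- A point of a cell shows that its condition holds at `v`; the infinite base then supplies
  -- another point outside `T`.
  gen∞-∖ : {G : Vec A (suc n) → Set ℓ} → Gen∞ G → ∀ v {T : A → Set ℓ} → Finite T →
    ∃[ x ] G (x ∷ v) → ∃[ x ] G (x ∷ v) × ¬ T x
  gen∞-∖ (none ¬G) v fin (x , g) = ⊥-elim (¬G _ g)
  gen∞-∖ (one (cell qf (υ , inf) e)) v fin (x , g) =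
    let y , u , ¬t = Infinite-∖ em (inf v) fin in y , from (e y v) (proj₁ (to (e x v) g) , u) , ¬t
  gen∞-∖ (both γ γ′ e) v fin (x , g) with to (e _) g
  ... | inj₁ g₁ = let y , h , ¬t = gen∞-∖ γ v fin (x , g₁) in y , from (e _) (inj₁ h) , ¬t
  ... | inj₂ g₂ = let y , h , ¬t = gen∞-∖ γ′ v fin (x , g₂) in y , from (e _) (inj₂ h) , ¬t

  qf-pos : {P : Vec A (suc n) → Set ℓ} → Pos P → QF (λ v → ∃[ x ] P (x ∷ v))
  qf-pos = qf-union λ { (cell qf λR e) → qf-cong
    (λ v → mk⇔ (λ (x , p) → let c , r = to (e x v) p in c , x , r) (λ (c , x , r) → x , from (e x v) (c , r)))
    (qf-∧ qf (qf-link λR)) }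

  qf-gen∞ : {G : Vec A (suc n) → Set ℓ} → Gen∞ G → QF (λ v → ∃[ x ] G (x ∷ v))
  qf-gen∞ = qf-union λ { (cell qf (υ , inf) e) → qf-cong
    (λ v → mk⇔ (λ (x , p) → proj₁ (to (e x v) p))
               (λ c → let x , u , _ = Infinite-∖ em (inf v) (Finite-list {P = λ _ → ⊥ℓ} [] λ _ ()) in x , from (e x v) (c , u)))
    qf }

  -- On `E`, the exceptions together with the finite generic cells, `inter` turns `Q` into a union
  -- of link cells. Off `E`, `Q` agrees with `G∞`; conversely a point of `G∞` can be moved off the
  -- finite fibre of `E`, where it lies in `Q`.
  qf-∃ : {Q : Vec A (suc n) → Set ℓ} → Tame Q → QF (λ v → ∃[ x ] Q (x ∷ v))
  qf-∃ {n} {Q} τ with gen-split (gen τ)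
  ... | F , G∞ , π , γ , d = qf-cong (λ v → mk⇔ (⇒ v) (⇐ v)) (qf-∨ (qf-pos (inter τ ε)) (qf-gen∞ γ))
    where
    E : Vec A (suc n) → Set ℓ
    E z = exception τ z ⊎ F z
    ε : Pos E
    ε = union-∨ (exceptional τ) π
    ⇒ : ∀ v → ∃[ x ] Q (x ∷ v) → (∃[ x ] E (x ∷ v) × Q (x ∷ v)) ⊎ (∃[ x ] G∞ (x ∷ v))
    ⇒ v (x , q) with em {E (x ∷ v)}
    ... | yes e = inj₁ (x , e , q)
    ... | no ¬e with to (d _) (to (agree τ _ (¬e ∘ inj₁)) q)
    ...   | inj₁ f = ⊥-elim (¬e (inj₂ f))
    ...   | inj₂ g = inj₂ (x , g)
    ⇐ : ∀ v → (∃[ x ] E (x ∷ v) × Q (x ∷ v)) ⊎ (∃[ x ] G∞ (x ∷ v)) → ∃[ x ] Q (x ∷ v)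
    ⇐ v (inj₁ (x , _ , q)) = x , q
    ⇐ v (inj₂ xg) = let x , g , ¬e = gen∞-∖ γ v (pos-finite ε v) xg in
      x , from (agree τ _ (¬e ∘ inj₁)) (from (d _) (inj₂ g))

  -- Induction on formulas and transfer to all models

  eliminate-∃ : {P : Vec A (suc n) → Set ℓ} → QF P → QF (λ v → ∃[ x ] P (x ∷ v))
  eliminate-∃ (ψ , qf , sat) = qf-cong
    (λ v → mk⇔ (λ (x , p) → x , to (sat _) p) (λ (x , s) → x , from (sat _) s)) (qf-∃ (tame-qf ψ qf))

  eliminate : (φ : Formula (CurveLanguage M̃) n) → QF (λ v → C ⊨ φ [ v ])
  eliminate ⊥′         = ⊥′ , _ , λ _ → ⇔-id _
  eliminate (s ≐ t)    = s ≐ t , _ , λ _ → ⇔-id _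
  eliminate (rel X ts) = rel X ts , _ , λ _ → ⇔-id _
  eliminate (φ ∧′ ψ)   = qf-∧ (eliminate φ) (eliminate ψ)
  eliminate (φ ∨′ ψ)   = qf-∨ (eliminate φ) (eliminate ψ)
  eliminate (φ ⇒′ ψ)   = qf-⇒ (eliminate φ) (eliminate ψ)
  eliminate (∀′ φ)     = qf-cong
    (λ v → mk⇔ (λ f (x , ¬s) → ¬s (f x)) (λ none x → ¬¬-elim em λ ¬s → none (x , ¬s)))
    (qf-¬ (eliminate-∃ (qf-¬ (eliminate φ))))
  eliminate (∃′ φ)     = eliminate-∃ (eliminate φ)

theorem3p5 : ∀ {ℓ} → ExcludedMiddle ℓ →
    (L : Language ℓ) (M : Structure L) → IsGeometric M →
    (M̃ : SaturatedExtension M) →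
    HasQE (Th (CurveStructure M̃))
theorem3p5 em L M geometric M̃ n φ with Curves.eliminate em M geometric M̃ φ
... | ψ , qf , equivalent = ψ , qf , λ N model v →
  -- The universal closure of the equivalence holds in the curve structure, so it belongs to the
  -- theory and holds in every model `N`.
  let φ⇒ψ , ψ⇒φ = to (sat-closure N φ⇔ψ) (model (closure φ⇔ψ)
        (from (sat-closure (CurveStructure M̃) φ⇔ψ) λ v → to (equivalent v) , from (equivalent v))) v
  in mk⇔ φ⇒ψ ψ⇒φ
  where
  φ⇔ψ : Formula (CurveLanguage M̃) n
  φ⇔ψ = (φ ⇒′ ψ) ∧′ (ψ ⇒′ φ)
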